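{- Let $n\ge 1$ and let $\ell$ be an integer with $(2n+4)/3 \leq \ell \leq n$. If $G$ and $G'$ are graphs on $n$ vertices with $\mathcal{D}_\ell(G)=\mathcal{D}_\ell(G')$, then $G$ is a tree if and only if $G'$ is a tree.
   Context: All graphs are finite, simple and undirected. For a graph $G$ and an integer $\ell$, the $\ell$-deck $\mathcal{D}_\ell(G)$ is the multiset of isomorphism classes of all induced subgraphs of $G$ on exactly $\ell$ vertices (one for each $\ell$-subset of $V(G)$). -}

module Defs where

open import Data.Nat using (ℕ; zero; suc; _≤_; _+_; _*_)
open import Data.Bool using (Bool; true; false)
open import Data.Fin using (Fin; zero; suc; inject₁; fromℕ)
open import Data.Fin.Subset using (Subset; _∈_; ∣_∣)
open import Data.Product using (Σ; Σ-syntax; _×_; proj₁; proj₂)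
open import Function.Bundles using (_⤖_; Bijection)
open import Function.Definitions using (Injective)
open import Relation.Binary.PropositionalEquality using (_≡_)
open import Relation.Nullary using (¬_)

record Graph (n : ℕ) : Set where
  field
    adj    : Fin n → Fin n → Bool
    sym    : ∀ u v → adj u v ≡ adj v u
    irrefl : ∀ v → adj v v ≡ false
open Graph public

Adj : ∀ {n} → Graph n → Fin n → Fin n → Set
Adj G u v = adj G u v ≡ true

Subsets : ℕ → ℕ → Set
Subsets n ℓ = Σ (Subset n) (λ S → ∣ S ∣ ≡ ℓ)

Elems : ∀ {n} → Subset n → Set
Elems {n} S = Σ (Fin n) (λ v → v ∈ S)

InducedIso : ∀ {n m} → Graph n → Subset n → Graph m → Subset m → Set
InducedIso G S G' S' =
  Σ[ f ∈ (Elems S ⤖ Elems S') ]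
    (∀ u v → adj G (proj₁ u) (proj₁ v)
             ≡ adj G' (proj₁ (Bijection.to f u)) (proj₁ (Bijection.to f v)))

-- D_ℓ(G) = D_ℓ(G') as multisets of isomorphism classes: there is a
-- bijection between the ℓ-subsets of V(G) and of V(G') such that
-- corresponding induced subgraphs are isomorphic.
SameDeck : ∀ {n m} → ℕ → Graph n → Graph m → Set
SameDeck {n} {m} ℓ G G' =
  Σ[ φ ∈ (Subsets n ℓ ⤖ Subsets m ℓ) ]
    (∀ S → InducedIso G (proj₁ S) G' (proj₁ (Bijection.to φ S)))

data Walk {n} (G : Graph n) : Fin n → Fin n → Set where
  here : ∀ {v} → Walk G v v
  step : ∀ {u v w} → Adj G u v → Walk G v w → Walk G u w

Connected : ∀ {n} → Graph n → Set
Connected G = ∀ u v → Walk G u v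

record Cycle {n} (G : Graph n) : Set where
  field
    m     : ℕ
    c     : Fin (suc (suc (suc m))) → Fin n
    inj   : Injective _≡_ _≡_ c
    edges : ∀ (i : Fin (suc (suc m))) → Adj G (c (inject₁ i)) (c (suc i))
    close : Adj G (c (fromℕ (suc (suc m)))) (c zero)

Acyclic : ∀ {n} → Graph n → Set
Acyclic G = ¬ Cycle G

IsTree : ∀ {n} → Graph n → Set
IsTree G = Connected G × Acyclic G

{-# OPTIONS --safe #-}
-- The invariant that separates trees from non-trees. Call an edge deep if it is the middle edge of a nonbacktracking
-- walk on 2r + 2 vertices, where 2r ≤ n − ℓ ≤ 2r + 1, and a vertex deep if it lies on a deep edge. In a forest the deep
-- vertices and edges form a forest again, so if there are any, there are more deep vertices than deep edges. Suppose G
-- is a tree, G′ has the same deck, and G′ has a cycle. The cycle is longer than ℓ, because shorter ones are visible on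
-- the cards. A nonbacktracking walk on 2r + 2 vertices then has no room to miss the cycle, so every deep vertex is near
-- it; each deep vertex is sent to the next vertex on the way to or around the cycle along a deep edge, and no edge is
-- used twice: there are at least as many deep edges as deep vertices.
--
-- Both numbers are determined by the deck. They are sums of functions each of which depends only on a ball of radius
-- r + 1. An ℓ-card inside the cycle of G′ yields a path on ℓ vertices in G, which meets such a ball of the tree in at
-- most 2r + 3 vertices. So balls in G have fewer than ℓ vertices, and so have those in G′, since a larger one would
-- contain a card that fits into a ball of G. For a function h of vertex subsets that depends only on ℓ vertices, the
-- polynomial Σ_S h(S) x^|S| is divisible by (1 + x)^(n − ℓ), hence its leading coefficient h(V) is determined by the
-- coefficients up to x^ℓ; these can be read off the deck (Kelly's lemma).
--
-- If G′ is acyclic, it is connected because it has as many edges as G.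
module Submission where

open import Defs renaming (sym to adj-sym; irrefl to adj-irrefl)
open import Data.Bool using (true; false; if_then_else_)
open import Data.Bool.Properties using () renaming (_≟_ to _≟ᵇ_)
open import Data.Empty using (⊥; ⊥-elim)
open import Data.Fin using (Fin; zero; suc; toℕ; inject₁; inject≤) renaming (_≟_ to _≟ᶠ_)
open import Data.Fin.Properties
  using (any?; all?; ¬∀⟶∃¬; toℕ-injective; toℕ-inject₁; toℕ-inject≤; toℕ-fromℕ; toℕ≤pred[n]; toℕ<n;
         inject≤-injective)
open import Data.Fin.Relation.Unary.Top using (view; ‵fromℕ; ‵inject₁)
open import Data.Fin.Subset using (Subset; _∈_; _∉_; _⊆_; _∩_; _∪_; _-_; ∣_∣; ⁅_⁆; ∁; ⊤; inside; outside)
open import Data.Fin.Subset.Properties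
  using (_∈?_; ∈⊤; ⊆⊤; ∣⊤∣≡n; ∣p∣≤n; p⊆q⇒∣p∣≤∣q∣; drop-∷-⊆; drop-there; nonempty?; x∈⁅x⁆; x∈⁅y⁆⇒x≡y; ∣⁅x⁆∣≡1;
         x∈p∩q⁺; x∈p∩q⁻; x∈p∪q⁺; x∈p∪q⁻; p─⊥≡p; p─q⊆p; x∈p∧x≢y⇒x∈p-y; x∈p⇒∣p-x∣<∣p∣; x∉p⇒x∈∁p; ∣∁p∣≡n∸∣p∣)
open import Data.List using (List; []; _∷_; _++_; map; length; allFin; tabulate)
open import Data.List.Membership.Propositional using () renaming (_∈_ to _∈ᴸ_)
import Data.List.Membership.DecPropositional as DecMembership
open import Data.List.Membership.Propositional.Properties using (∈-map⁺; ∈-map⁻; ∈-++⁺ˡ; ∈-++⁺ʳ; ∈-allFin)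
open import Data.List.Properties using (map-tabulate; length-tabulate)
open import Data.List.Relation.Unary.All as All using (All; []; _∷_)
open import Data.List.Relation.Unary.All.Properties using (¬Any⇒All¬)
open import Data.List.Relation.Unary.AllPairs using ([]; _∷_)
open import Data.List.Relation.Unary.Any using (here; there)
open import Data.List.Relation.Unary.Unique.Propositional using (Unique)
import Data.List.Relation.Unary.Unique.Propositional.Properties as Unique
open import Data.Nat hiding (∣_-_∣)
open import Data.Nat.Properties
open import Algebra.Properties.CommutativeSemigroup +-commutativeSemigroup using (interchange)
open import Data.Nat.Tactic.RingSolver using (solve-∀)
open import Data.Product using (Σ; ∃; ∃₂; _×_; _,_; proj₁; proj₂)
open import Data.Sum using (_⊎_; inj₁; inj₂)
import Data.Unit as Unit
open import Data.Vec as Vec using ([]; _∷_; here; there)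
import Data.Vec.Properties as Vec
open import Data.Vec.Properties.WithK using ([]=-irrelevant)
open import Function using (_∘_; id; case_of_)
open import Function.Bundles using (_⇔_; mk⇔; Bijection)
open import Function.Definitions using (Injective)
open import Relation.Binary.PropositionalEquality
open import Relation.Nullary using (Dec; yes; no; ¬_; does)
open import Relation.Nullary.Decidable
  using (_×-dec_; _⊎-dec_; _→-dec_; ¬?; dec-true; dec-false; decidable-stable; does-⇔)

-- Sums over lists, vertices and k-subsets

does-true : {P : Set} (d : Dec P) → does d ≡ true → P
does-true (yes p) _ = p

ind : {P : Set} → Dec P → ℕ
ind d = if does d then 1 else 0

ind-yes : {P : Set} (d : Dec P) → P → ind d ≡ 1
ind-yes d p rewrite dec-true d p = refl

ind-no : {P : Set} (d : Dec P) → ¬ P → ind d ≡ 0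
ind-no d ¬p rewrite dec-false d ¬p = refl

ind-≢0 : {P : Set} (d : Dec P) → ind d ≢ 0 → P
ind-≢0 (yes p) _ = p
ind-≢0 (no _) ≢0 = ⊥-elim (≢0 refl)

ind-mono : {P Q : Set} (d : Dec P) (e : Dec Q) → (P → Q) → ind d ≤ ind e
ind-mono (no _) e f = z≤n
ind-mono (yes p) e f = ≤-reflexive (sym (ind-yes e (f p)))

ind-cong : {P Q : Set} (d : Dec P) (e : Dec Q) → (P → Q) → (Q → P) → ind d ≡ ind e
ind-cong d e f g = ≤-antisym (ind-mono d e f) (ind-mono e d g)

ind-≤ : {P : Set} (d : Dec P) {k : ℕ} → (P → 1 ≤ k) → ind d ≤ k
ind-≤ (no _) f = z≤n
ind-≤ (yes p) f = f p

ind-exclusive : {P Q R : Set} (d : Dec P) (e : Dec Q) (c : Dec R) →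
  (P → R) → (Q → R) → (P → Q → ⊥) → ind d + ind e ≤ ind c
ind-exclusive (no _) e c f g excl = ind-mono e c g
ind-exclusive (yes p) e c f g excl = ≤-reflexive (trans (cong suc (ind-no e (excl p))) (sym (ind-yes c (f p))))

sumL : {A : Set} → List A → (A → ℕ) → ℕ
sumL [] f = 0
sumL (x ∷ xs) f = f x + sumL xs f

module _ {A : Set} where

  sumL-cong : ∀ xs {f g : A → ℕ} → (∀ x → f x ≡ g x) → sumL xs f ≡ sumL xs g
  sumL-cong [] eq = refl
  sumL-cong (x ∷ xs) eq = cong₂ _+_ (eq x) (sumL-cong xs eq)

  sumL-mono : ∀ xs {f g : A → ℕ} → (∀ x → f x ≤ g x) → sumL xs f ≤ sumL xs g
  sumL-mono [] le = z≤n
  sumL-mono (x ∷ xs) le = +-mono-≤ (le x) (sumL-mono xs le)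

  sumL-0 : ∀ xs → sumL {A} xs (λ _ → 0) ≡ 0
  sumL-0 [] = refl
  sumL-0 (x ∷ xs) = sumL-0 xs

  sumL-+ : ∀ xs (f g : A → ℕ) → sumL xs (λ x → f x + g x) ≡ sumL xs f + sumL xs g
  sumL-+ [] f g = refl
  sumL-+ (x ∷ xs) f g = trans (cong (f x + g x +_) (sumL-+ xs f g)) (interchange (f x) (g x) (sumL xs f) (sumL xs g))

  sumL-++ : ∀ xs ys (f : A → ℕ) → sumL (xs ++ ys) f ≡ sumL xs f + sumL ys f
  sumL-++ [] ys f = refl
  sumL-++ (x ∷ xs) ys f = trans (cong (f x +_) (sumL-++ xs ys f)) (sym (+-assoc (f x) _ _))

  sumL-map : ∀ {B : Set} (h : B → A) xs (f : A → ℕ) → sumL (map h xs) f ≡ sumL xs (f ∘ h)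
  sumL-map h [] f = refl
  sumL-map h (x ∷ xs) f = cong (f (h x) +_) (sumL-map h xs f)

  sumL-∈ : ∀ {xs} (f : A → ℕ) {x} → x ∈ᴸ xs → f x ≤ sumL xs f
  sumL-∈ f (here refl) = m≤m+n _ _
  sumL-∈ f (there x∈) = ≤-trans (sumL-∈ f x∈) (m≤n+m _ _)

  sumL-≢0 : ∀ xs (f : A → ℕ) → sumL xs f ≢ 0 → ∃ λ x → f x ≢ 0
  sumL-≢0 [] f ≢0 = ⊥-elim (≢0 refl)
  sumL-≢0 (x ∷ xs) f ≢0 with f x ≟ 0
  ... | no fx≢0 = x , fx≢0
  ... | yes fx≡0 = sumL-≢0 xs f (λ eq → ≢0 (cong₂ _+_ fx≡0 eq))

  sumL-atMostOne : ∀ {xs} (f : A → ℕ) {b} → Unique xs → (∀ x → f x ≤ b) →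
    (∀ x y → f x ≢ 0 → f y ≢ 0 → x ≡ y) → sumL xs f ≤ b
  sumL-atMostOne f [] le one = z≤n
  sumL-atMostOne {x ∷ xs} f {b} (x∉ ∷ u) le one with f x ≟ 0
  ... | yes fx≡0 rewrite fx≡0 = sumL-atMostOne f u le one
  ... | no fx≢0 = subst (_≤ b) (sym (trans (cong (f x +_) (rest xs x∉)) (+-identityʳ _))) (le x)
    where
    rest : ∀ ys → All (x ≢_) ys → sumL ys f ≡ 0
    rest [] [] = refl
    rest (y ∷ ys) (x≢y ∷ x∉ys) with f y ≟ 0
    ... | yes fy≡0 = cong₂ _+_ fy≡0 (rest ys x∉ys)
    ... | no fy≢0 = ⊥-elim (x≢y (one x y fx≢0 fy≢0))

sumL-comm : ∀ {A B : Set} (xs : List A) (ys : List B) (f : A → B → ℕ) →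
  sumL xs (λ x → sumL ys (f x)) ≡ sumL ys (λ y → sumL xs (λ x → f x y))
sumL-comm [] ys f = sym (sumL-0 ys)
sumL-comm (x ∷ xs) ys f = trans (cong (sumL ys (f x) +_) (sumL-comm xs ys f))
  (sym (sumL-+ ys (f x) (λ y → sumL xs (λ x → f x y))))

-- Double counting: `K` places the weight `a x` in the cell `(x , to x)`. Row `x` sums to at least
-- `a x`, and column `y` has at most one nonzero entry, which is at most `b y`. Conditions on `to`
-- are imposed only on the support of `a`, since the maps used later are controlled only on a vertex
-- subset.
sumL-inject : ∀ {A B : Set} (_≟ᴮ_ : (x y : B) → Dec (x ≡ y)) {xs : List A} {ys : List B}
  (a : A → ℕ) (b : B → ℕ) (to : A → B) → Unique xs →
  (∀ x → a x ≢ 0 → to x ∈ᴸ ys × a x ≤ b (to x)) →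
  (∀ x y → a x ≢ 0 → a y ≢ 0 → to x ≡ to y → x ≡ y) →
  sumL xs a ≤ sumL ys b
sumL-inject {A} {B} _≟ᴮ_ {xs} {ys} a b to u into inj =
  ≤-trans (sumL-mono xs row) (≤-trans (≤-reflexive (sumL-comm xs ys K)) (sumL-mono ys column))
  where
  K : A → B → ℕ
  K x y = ind (to x ≟ᴮ y) * a x

  K-support : ∀ x y → K x y ≢ 0 → to x ≡ y × a x ≢ 0
  K-support x y ≢0 = ind-≢0 (to x ≟ᴮ y) (λ eq → ≢0 (cong (_* a x) eq)) ,
    (λ eq → ≢0 (trans (cong (ind (to x ≟ᴮ y) *_) eq) (*-zeroʳ (ind (to x ≟ᴮ y)))))

  row : ∀ x → a x ≤ sumL ys (K x)
  row x with a x ≟ 0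
  ... | yes eq = subst (_≤ sumL ys (K x)) (sym eq) z≤n
  ... | no ≢0 = ≤-trans (≤-reflexive (sym (trans (cong (_* a x) (ind-yes (to x ≟ᴮ to x) refl)) (+-identityʳ _))))
                        (sumL-∈ (K x) (proj₁ (into x ≢0)))

  bound : ∀ x y → K x y ≤ b y
  bound x y with K x y ≟ 0
  ... | yes eq = subst (_≤ b y) (sym eq) z≤n
  ... | no ≢0 with K-support x y ≢0
  ...   | refl , ax≢0 = ≤-trans (≤-reflexive (trans (cong (_* a x) (ind-yes (to x ≟ᴮ to x) refl)) (+-identityʳ _)))
                                (proj₂ (into x ax≢0))

  column : ∀ y → sumL xs (λ x → K x y) ≤ b y
  column y = sumL-atMostOne (λ x → K x y) u (λ x → bound x y) λ x x′ p q →
    let (e , ax) = K-support x y p ; (e′ , ax′) = K-support x′ y q in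
    inj x x′ ax ax′ (trans e (sym e′))

sumF : ∀ {n} → (Fin n → ℕ) → ℕ
sumF {n} = sumL (allFin n)

sumF-suc : ∀ {n} (f : Fin (suc n) → ℕ) → sumF f ≡ f zero + sumF (f ∘ suc)
sumF-suc {n} f = cong (f zero +_) (trans (cong (λ xs → sumL xs f) (sym (map-tabulate (λ x → x) suc))) (sumL-map suc (allFin n) f))

sumF-∈ : ∀ {n} (f : Fin n → ℕ) x → f x ≤ sumF f
sumF-∈ f x = sumL-∈ f (∈-allFin x)

sumF-single : ∀ {n} (f : Fin n → ℕ) y → (∀ x → f x ≢ 0 → x ≡ y) → sumF f ≡ f y
sumF-single {n} f y only = ≤-antisym (sumL-atMostOne f (Unique.allFin⁺ n) le
    (λ x x′ p q → trans (only x p) (sym (only x′ q)))) (sumF-∈ f y)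
  where
  le : ∀ x → f x ≤ f y
  le x with f x ≟ 0
  ... | yes eq = subst (_≤ f y) (sym eq) z≤n
  ... | no ≢0 = ≤-reflexive (cong f (only x ≢0))

subsets : ∀ n → ℕ → List (Subset n)
subsets zero zero = [] ∷ []
subsets zero (suc k) = []
subsets (suc n) zero = map (outside ∷_) (subsets n zero)
subsets (suc n) (suc k) = map (outside ∷_) (subsets n (suc k)) ++ map (inside ∷_) (subsets n k)

subsets-complete : ∀ {n} (S : Subset n) → S ∈ᴸ subsets n ∣ S ∣
subsets-complete [] = here refl
subsets-complete (true ∷ S) = ∈-++⁺ʳ (map (outside ∷_) (subsets _ (suc ∣ S ∣))) (∈-map⁺ (inside ∷_) (subsets-complete S))
subsets-complete (false ∷ S) with ∣ S ∣ | subsets-complete S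
... | zero | S∈ = ∈-map⁺ (outside ∷_) S∈
... | suc k | S∈ = ∈-++⁺ˡ (∈-map⁺ (outside ∷_) S∈)

subsets-unique : ∀ n k → Unique (subsets n k)
subsets-unique zero zero = [] ∷ []
subsets-unique zero (suc k) = []
subsets-unique (suc n) zero = Unique.map⁺ Vec.∷-injectiveʳ (subsets-unique n zero)
subsets-unique (suc n) (suc k) =
  Unique.++⁺ (Unique.map⁺ Vec.∷-injectiveʳ (subsets-unique n (suc k))) (Unique.map⁺ Vec.∷-injectiveʳ (subsets-unique n k)) disjoint
  where
  disjoint : ∀ {S} → S ∈ᴸ map (outside ∷_) (subsets n (suc k)) × S ∈ᴸ map (inside ∷_) (subsets n k) → ⊥
  disjoint (p , q) with ∈-map⁻ (outside ∷_) p | ∈-map⁻ (inside ∷_) q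
  ... | _ , _ , refl | _ , _ , ()

-- The coefficient of x^k in the polynomial Σ_S h(S) x^|S|.
total : ∀ {n} → (Subset n → ℕ) → ℕ → ℕ
total {n} h k = sumL (subsets n k) h

shift : (ℕ → ℕ) → ℕ → ℕ
shift a zero = 0
shift a (suc k) = a k

-- Subsets are sorted by whether they contain the first vertex; `shift` is multiplication by x and
-- accounts for that vertex when it is present.
total-∷ : ∀ {n} (h : Subset (suc n) → ℕ) k →
  total h k ≡ total (h ∘ (outside ∷_)) k + shift (total (h ∘ (inside ∷_))) k
total-∷ {n} h zero = trans (sumL-map (outside ∷_) (subsets n zero) h) (sym (+-identityʳ _))
total-∷ {n} h (suc k) = trans (sumL-++ (map (outside ∷_) (subsets n (suc k))) _ h)
  (cong₂ _+_ (sumL-map (outside ∷_) (subsets n (suc k)) h) (sumL-map (inside ∷_) (subsets n k) h))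

total-cong : ∀ {n} k {h h′ : Subset n → ℕ} → (∀ S → ∣ S ∣ ≡ k → h S ≡ h′ S) → total h k ≡ total h′ k
total-cong {zero} zero eq = cong (_+ 0) (eq [] refl)
total-cong {zero} (suc k) eq = refl
total-cong {suc n} zero {h} {h′} eq = trans (total-∷ h zero)
  (trans (cong (_+ 0) (total-cong zero (λ S → eq (outside ∷ S)))) (sym (total-∷ h′ zero)))
total-cong {suc n} (suc k) {h} {h′} eq = trans (total-∷ h (suc k)) (trans
  (cong₂ _+_ (total-cong (suc k) (λ S → eq (outside ∷ S))) (total-cong k (λ S e → eq (inside ∷ S) (cong suc e)))) (sym (total-∷ h′ (suc k))))

total-> : ∀ {n} (h : Subset n → ℕ) k → n < k → total h k ≡ 0
total-> {zero} h (suc k) lt = refl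
total-> {suc n} h (suc k) (s≤s lt) = trans (total-∷ h (suc k)) (cong₂ _+_ (total-> _ (suc k) (m<n⇒m<1+n lt)) (total-> _ k lt))

total-⊤ : ∀ {n} (h : Subset n → ℕ) → total h n ≡ h ⊤
total-⊤ {zero} h = +-identityʳ _
total-⊤ {suc n} h = trans (total-∷ h (suc n)) (cong₂ _+_ (total-> _ (suc n) ≤-refl) (total-⊤ (h ∘ (inside ∷_))))

-- Deleting one vertex from a subset

deletions : ∀ {n} → (Subset n → ℕ) → Subset n → ℕ
deletions h S = sumF (λ v → ind (v ∈? S) * h (S - v))

deletions-out : ∀ {n} (h : Subset (suc n) → ℕ) S → deletions h (outside ∷ S) ≡ deletions (h ∘ (outside ∷_)) S
deletions-out h S = sumF-suc (λ v → ind (v ∈? (outside ∷ S)) * h ((outside ∷ S) - v))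

deletions-in : ∀ {n} (h : Subset (suc n) → ℕ) S →
  deletions h (inside ∷ S) ≡ h (outside ∷ S) + deletions (h ∘ (inside ∷_)) S
deletions-in h S = trans (sumF-suc (λ v → ind (v ∈? (inside ∷ S)) * h ((inside ∷ S) - v)))
  (cong (_+ deletions (h ∘ (inside ∷_)) S) (trans (+-identityʳ _) (cong (λ T → h (outside ∷ T)) (p─⊥≡p S))))

total-deletions-0 : ∀ {n} (h : Subset n → ℕ) → total (deletions h) 0 ≡ 0
total-deletions-0 {zero} h = refl
total-deletions-0 {suc n} h = trans (total-∷ (deletions h) 0) (trans (+-identityʳ _)
  (trans (sumL-cong (subsets n 0) (deletions-out h)) (total-deletions-0 (h ∘ (outside ∷_)))))

-- A k-subset S arises as U − v from exactly n − k pairs (U , v).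
total-deletions : ∀ {n} (h : Subset n → ℕ) k → total (deletions h) (suc k) + k * total h k ≡ n * total h k
total-deletions {zero} h zero = refl
total-deletions {zero} h (suc k) = *-zeroʳ (suc k)
total-deletions {suc n} h k = begin
  total (deletions h) (suc k) + k * total h k
    ≡⟨ cong₂ (λ x y → x + k * y) expand (total-∷ h k) ⟩
  d₀ + (a₀ + d₁ k) + k * (a₀ + shift a₁ k)
    ≡⟨ arrange d₀ a₀ (d₁ k) (shift a₁ k) k ⟩
  (d₀ + k * a₀) + a₀ + (d₁ k + k * shift a₁ k)
    ≡⟨ cong₂ (λ x y → x + a₀ + y) (total-deletions h₀ k) (tail k) ⟩
  n * a₀ + a₀ + (n * shift a₁ k + shift a₁ k)
    ≡⟨ arrange′ n a₀ (shift a₁ k) ⟩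
  suc n * (a₀ + shift a₁ k)
    ≡⟨ cong (suc n *_) (total-∷ h k) ⟨
  suc n * total h k ∎
  where
  open ≡-Reasoning
  h₀ h₁ : Subset n → ℕ
  h₀ = h ∘ (outside ∷_)
  h₁ = h ∘ (inside ∷_)
  d₀ a₀ : ℕ
  d₀ = total (deletions h₀) (suc k)
  a₀ = total h₀ k
  a₁ d₁ : ℕ → ℕ
  a₁ = total h₁
  d₁ = total (deletions h₁)
  expand : total (deletions h) (suc k) ≡ d₀ + (a₀ + d₁ k)
  expand = trans (total-∷ (deletions h) (suc k)) (cong₂ _+_ (sumL-cong (subsets n (suc k)) (deletions-out h))
    (trans (sumL-cong (subsets n k) (deletions-in h)) (sumL-+ (subsets n k) h₀ (deletions h₁))))
  -- The subsets containing the first vertex use the induction hypothesis one degree lower. At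
  -- degree 0 nothing can be deleted and both sides vanish.
  tail : ∀ k → d₁ k + k * shift a₁ k ≡ n * shift a₁ k + shift a₁ k
  tail zero = trans (+-identityʳ _) (trans (total-deletions-0 h₁) (sym (trans (+-identityʳ _) (*-zeroʳ n))))
  tail (suc k) = trans (split (d₁ (suc k)) k (a₁ k)) (cong (_+ a₁ k) (total-deletions h₁ k))
    where
    split : ∀ d k a → d + suc k * a ≡ d + k * a + a
    split = solve-∀
  arrange : ∀ d a e b k → d + (a + e) + k * (a + b) ≡ (d + k * a) + a + (e + k * b)
  arrange = solve-∀
  arrange′ : ∀ n a b → n * a + a + (n * b + b) ≡ suc n * (a + b)
  arrange′ = solve-∀

-- Sequences are read as polynomials, so binomial t is multiplication by (1 + x)ᵗ.
binomial : ℕ → (ℕ → ℕ) → ℕ → ℕ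
binomial zero a k = a k
binomial (suc t) a k = binomial t a k + shift (binomial t a) k

shift-cong : ∀ {a b} → (∀ k → a k ≡ b k) → ∀ k → shift a k ≡ shift b k
shift-cong eq zero = refl
shift-cong eq (suc k) = eq k

binomial-cong : ∀ t {a b} → (∀ k → a k ≡ b k) → ∀ k → binomial t a k ≡ binomial t b k
binomial-cong zero eq k = eq k
binomial-cong (suc t) eq k = cong₂ _+_ (binomial-cong t eq k) (shift-cong (binomial-cong t eq) k)

binomial-0 : ∀ t k → binomial t (λ _ → 0) k ≡ 0
binomial-0 zero k = refl
binomial-0 (suc t) zero = trans (+-identityʳ _) (binomial-0 t zero)
binomial-0 (suc t) (suc k) = cong₂ _+_ (binomial-0 t (suc k)) (binomial-0 t k)

binomial-+ : ∀ t a b k → binomial t (λ i → a i + b i) k ≡ binomial t a k + binomial t b k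
binomial-+ zero a b k = refl
binomial-+ (suc t) a b k = trans (cong₂ _+_ (binomial-+ t a b k)
    (trans (shift-cong (binomial-+ t a b) k) (shift-+ k))) (interchange (binomial t a k) (binomial t b k) _ _)
  where
  shift-+ : ∀ {a b} k → shift (λ i → a i + b i) k ≡ shift a k + shift b k
  shift-+ zero = refl
  shift-+ (suc k) = refl

binomial-shift : ∀ t a k → binomial t (shift a) k ≡ shift (binomial t a) k
binomial-shift zero a k = refl
binomial-shift (suc t) a zero = trans (+-identityʳ _) (binomial-shift t a zero)
binomial-shift (suc t) a (suc k) = cong₂ _+_ (binomial-shift t a (suc k)) (binomial-shift t a k)

-- The constant term of 1 + x is 1, so multiplication by it is invertible modulo x^(m + 1):
-- coefficients are recovered in increasing order by cancelling the shifted term.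
binomial-injective : ∀ t m {a b} → (∀ k → k ≤ m → binomial t a k ≡ binomial t b k) → ∀ k → k ≤ m → a k ≡ b k
binomial-injective zero m eq = eq
binomial-injective (suc t) m {a} {b} eq = binomial-injective t m agree
  where
  agree : ∀ k → k ≤ m → binomial t a k ≡ binomial t b k
  agree zero le = trans (sym (+-identityʳ _)) (trans (eq zero le) (+-identityʳ _))
  agree (suc k) le = +-cancelʳ-≡ (binomial t a k) _ _
    (trans (eq (suc k) le) (cong (binomial t b (suc k) +_) (sym (agree k (<⇒≤ le)))))

-- Divisibility by powers of 1 + x

-- The last clause says that the quotient `q` has degree at most n - t, written without truncated
-- subtraction.
Divisible : ∀ {n} → ℕ → (Subset n → ℕ) → Set
Divisible {n} t h = ∃ λ q → (∀ k → total h k ≡ binomial t q k) × (∀ k → n < t + k → q k ≡ 0)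

DependsOn : ∀ {n} → Subset n → (Subset n → ℕ) → Set
DependsOn B h = ∀ S S′ → S ∩ B ≡ S′ ∩ B → h S ≡ h S′

-- A vertex outside `B` contributes a factor 1 + x, because `h` has the same value with and without
-- it; a vertex in `B` splits the polynomial into two summands. The size condition guarantees `t`
-- vertices outside `B`.
divisible-dependsOn : ∀ {n} t B (h : Subset n → ℕ) → DependsOn B h → ∣ B ∣ + t ≤ n → Divisible t h
divisible-dependsOn {zero} zero [] h dep le = total h , (λ k → refl) , total-> h
divisible-dependsOn {suc n} t (true ∷ B) h dep (s≤s le)
  with divisible-dependsOn t B (h ∘ (outside ∷_)) (λ S S′ eq → dep _ _ (cong (outside ∷_) eq)) le
     | divisible-dependsOn t B (h ∘ (inside ∷_)) (λ S S′ eq → dep _ _ (cong (inside ∷_) eq)) le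
... | q₀ , eq₀ , deg₀ | q₁ , eq₁ , deg₁ = q , eq , deg
  where
  q : ℕ → ℕ
  q k = q₀ k + shift q₁ k
  eq : ∀ k → total h k ≡ binomial t q k
  eq k = trans (total-∷ h k) (trans (cong₂ _+_ (eq₀ k) (trans (shift-cong eq₁ k) (sym (binomial-shift t q₁ k))))
    (sym (binomial-+ t q₀ (shift q₁) k)))
  deg : ∀ k → suc n < t + k → q k ≡ 0
  deg zero lt = trans (+-identityʳ _) (deg₀ zero (<⇒≤ lt))
  deg (suc k) lt = cong₂ _+_ (deg₀ (suc k) (<⇒≤ lt)) (deg₁ k (≤-pred (subst (suc n <_) (+-suc t k) lt)))
divisible-dependsOn {suc n} zero (false ∷ B) h dep le = total h , (λ k → refl) , total-> h
divisible-dependsOn {suc n} (suc t) (false ∷ B) h dep le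
  with divisible-dependsOn t B (h ∘ (outside ∷_)) (λ S S′ eq → dep _ _ (cong (outside ∷_) eq))
         (≤-pred (subst (_≤ suc n) (+-suc ∣ B ∣ t) le))
... | q , eq , deg = q , eq′ , (λ k lt → deg k (≤-pred lt))
  where
  eq′ : ∀ k → total h k ≡ binomial (suc t) q k
  eq′ k = trans (total-∷ h k) (cong₂ _+_ (eq k)
    (shift-cong (λ j → trans (sumL-cong (subsets n j) (λ S → dep (inside ∷ S) (outside ∷ S) refl)) (eq j)) k))

divisible-sum : ∀ {n} {I : Set} t (is : List I) (h : I → Subset n → ℕ) →
  (∀ i → Divisible t (h i)) → Divisible t (λ S → sumL is (λ i → h i S))
divisible-sum {n} t [] h div = (λ _ → 0) , (λ k → trans (sumL-0 (subsets n k)) (sym (binomial-0 t k))) , (λ _ _ → refl)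
divisible-sum {n} t (i ∷ is) h div with div i | divisible-sum t is h div
... | q , eq , deg | q′ , eq′ , deg′ = (λ k → q k + q′ k) ,
  (λ k → trans (sumL-+ (subsets n k) (h i) _) (trans (cong₂ _+_ (eq k) (eq′ k)) (sym (binomial-+ t q q′ k)))) ,
  (λ k lt → cong₂ _+_ (deg k lt) (deg′ k lt))

-- Both quotients have degree at most `m`, and `binomial-injective` recovers their coefficients up
-- to `m` from the totals up to `m`. Hence the polynomials coincide, and `h ⊤` is the coefficient of
-- x^n.
divisible-determined : ∀ {n} t m {h h′ : Subset n → ℕ} → t + m ≡ n → Divisible t h → Divisible t h′ →
  (∀ k → k ≤ m → total h k ≡ total h′ k) → h ⊤ ≡ h′ ⊤
divisible-determined {n} t m {h} {h′} t+m≡n (q , eq , deg) (q′ , eq′ , deg′) agree =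
  trans (sym (total-⊤ h)) (trans (eq n) (trans (binomial-cong t q≡q′ n) (trans (sym (eq′ n)) (total-⊤ h′))))
  where
  q≡q′ : ∀ k → q k ≡ q′ k
  q≡q′ k with k ≤? m
  ... | yes le = binomial-injective t m (λ j le → trans (sym (eq j)) (trans (agree j le) (eq′ j))) k le
  ... | no nle = trans (deg k n<) (sym (deg′ k n<))
    where
    n< : n < t + k
    n< = subst (_< t + k) t+m≡n (+-monoʳ-< t (≰⇒> nle))

-- Kelly's lemma for monotone functions of induced subgraphs

x∉p-x : ∀ {n} (p : Subset n) x → x ∉ p - x
x∉p-x (s ∷ p) zero ()
x∉p-x (s ∷ p) (suc x) (there x∈) = x∉p-x p x x∈

-- The map is total and constrained only on `S`, so it can reindex sums over all vertices.
record Embedding {n} (G : Graph n) (S : Subset n) (G′ : Graph n) (S′ : Subset n) : Set where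
  field
    to     : Fin n → Fin n
    to-∈   : ∀ {v} → v ∈ S → to v ∈ S′
    to-inj : ∀ {u v} → u ∈ S → v ∈ S → to u ≡ to v → u ≡ v
    to-adj : ∀ {u v} → u ∈ S → v ∈ S → adj G u v ≡ adj G′ (to u) (to v)

-- One direction of `SameDeck`. Each direction yields an inequality between totals of a monotone
-- function, and the two together yield equality.
record DeckEmbedding {n} (ℓ : ℕ) (G G′ : Graph n) : Set where
  field
    card      : Subset n → Subset n
    card-size : ∀ S → ∣ S ∣ ≡ ℓ → ∣ card S ∣ ≡ ℓ
    card-inj  : ∀ {S T} → ∣ S ∣ ≡ ℓ → ∣ T ∣ ≡ ℓ → card S ≡ card T → S ≡ T
    card-emb  : ∀ S → ∣ S ∣ ≡ ℓ → Embedding G S G′ (card S)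

Elems-≡ : ∀ {n} {S : Subset n} {x y : Elems S} → proj₁ x ≡ proj₁ y → x ≡ y
Elems-≡ {x = x , p} {y = .x , q} refl = cong (x ,_) ([]=-irrelevant p q)

Subsets-≡ : ∀ {n ℓ} {x y : Subsets n ℓ} → proj₁ x ≡ proj₁ y → x ≡ y
Subsets-≡ {x = S , p} {y = .S , q} refl = cong (S ,_) (≡-irrelevant p q)

module _ {n} {S S′ : Subset n} (f : Elems S → Elems S′) where

  extend : Fin n → Fin n
  extend v with v ∈? S
  ... | yes v∈ = proj₁ (f (v , v∈))
  ... | no _ = v

  extend-≡ : ∀ {v} (v∈ : v ∈ S) → extend v ≡ proj₁ (f (v , v∈))
  extend-≡ {v} v∈ with v ∈? S
  ... | yes v∈′ = cong (λ p → proj₁ (f (v , p))) ([]=-irrelevant v∈′ v∈)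
  ... | no v∉ = ⊥-elim (v∉ v∈)

  embedding : ∀ {G G′ : Graph n} → (∀ {x y} → f x ≡ f y → x ≡ y) →
    (∀ x y → adj G (proj₁ x) (proj₁ y) ≡ adj G′ (proj₁ (f x)) (proj₁ (f y))) → Embedding G S G′ S′
  embedding {G} {G′} inj adj-f = record
    { to = extend
    ; to-∈ = λ v∈ → subst (_∈ S′) (sym (extend-≡ v∈)) (proj₂ (f (_ , v∈)))
    ; to-inj = λ u∈ v∈ eq → cong proj₁ (inj (Elems-≡ (trans (sym (extend-≡ u∈)) (trans eq (extend-≡ v∈)))))
    ; to-adj = λ u∈ v∈ → trans (adj-f (_ , u∈) (_ , v∈)) (sym (cong₂ (adj G′) (extend-≡ u∈) (extend-≡ v∈)))
    }

iso⇒embedding : ∀ {n} {G G′ : Graph n} {S S′} → InducedIso G S G′ S′ → Embedding G S G′ S′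
iso⇒embedding (f , adj-f) = embedding (Bijection.to f) (Bijection.injective f) adj-f

iso⇒embeddingʳ : ∀ {n} {G G′ : Graph n} {S S′} → InducedIso G S G′ S′ → Embedding G′ S′ G S
iso⇒embeddingʳ {G = G} {G′} {S} {S′} (f , adj-f) = embedding from from-inj from-adj
  where
  open Bijection f using (to; surjective)
  from : Elems S′ → Elems S
  from y = proj₁ (surjective y)
  to-from : ∀ y → to (from y) ≡ y
  to-from y = proj₂ (surjective y) refl
  from-inj : ∀ {x y} → from x ≡ from y → x ≡ y
  from-inj {x} {y} eq = trans (sym (to-from x)) (trans (cong to eq) (to-from y))
  from-adj : ∀ x y → adj G′ (proj₁ x) (proj₁ y) ≡ adj G (proj₁ (from x)) (proj₁ (from y))
  from-adj x y = trans (sym (cong₂ (λ u v → adj G′ (proj₁ u) (proj₁ v)) (to-from x) (to-from y)))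
                       (sym (adj-f (from x) (from y)))

module _ {n ℓ} (f : Subsets n ℓ → Subsets n ℓ) where

  extendCard : Subset n → Subset n
  extendCard S with ∣ S ∣ ≟ ℓ
  ... | yes p = proj₁ (f (S , p))
  ... | no _ = S

  extendCard-≡ : ∀ {S} (p : ∣ S ∣ ≡ ℓ) → extendCard S ≡ proj₁ (f (S , p))
  extendCard-≡ {S} p with ∣ S ∣ ≟ ℓ
  ... | yes q = cong (λ r → proj₁ (f (S , r))) (≡-irrelevant q p)
  ... | no ¬p = ⊥-elim (¬p p)

  deckEmbedding : ∀ {G G′ : Graph n} → (∀ {S T} → f S ≡ f T → S ≡ T) →
    (∀ S → Embedding G (proj₁ S) G′ (proj₁ (f S))) → DeckEmbedding ℓ G G′
  deckEmbedding {G} {G′} inj emb = record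
    { card = extendCard
    ; card-size = λ S p → trans (cong ∣_∣ (extendCard-≡ p)) (proj₂ (f (S , p)))
    ; card-inj = λ p q eq → cong proj₁ (inj (Subsets-≡ (trans (sym (extendCard-≡ p)) (trans eq (extendCard-≡ q)))))
    ; card-emb = λ S p → subst (Embedding G S G′) (sym (extendCard-≡ p)) (emb (S , p))
    }

sameDeck⇒deckEmbedding : ∀ {n ℓ} {G G′ : Graph n} → SameDeck ℓ G G′ → DeckEmbedding ℓ G G′
sameDeck⇒deckEmbedding (φ , iso) =
  deckEmbedding (Bijection.to φ) (Bijection.injective φ) (λ S → iso⇒embedding (iso S))

sameDeck⇒deckEmbeddingʳ : ∀ {n ℓ} {G G′ : Graph n} → SameDeck ℓ G G′ → DeckEmbedding ℓ G′ G
sameDeck⇒deckEmbeddingʳ {n} {ℓ} {G} {G′} (φ , iso) = deckEmbedding from from-inj emb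
  where
  open Bijection φ using (to; surjective)
  from : Subsets n ℓ → Subsets n ℓ
  from S = proj₁ (surjective S)
  to-from : ∀ S → to (from S) ≡ S
  to-from S = proj₂ (surjective S) refl
  from-inj : ∀ {S T} → from S ≡ from T → S ≡ T
  from-inj {S} {T} eq = trans (sym (to-from S)) (trans (cong to eq) (to-from T))
  emb : ∀ S → Embedding G′ (proj₁ S) G (proj₁ (from S))
  emb S = iso⇒embeddingʳ (subst (λ T → InducedIso G (proj₁ (from S)) G′ (proj₁ T)) (to-from S) (iso (from S)))

-- An isomorphism is an embedding both ways, so a monotone F is an isomorphism invariant.
Monotone : ∀ {n} → (Graph n → Subset n → ℕ) → Set
Monotone {n} F = ∀ {G G′ : Graph n} {S S′} → Embedding G S G′ S′ → F G S ≤ F G′ S′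

embedding-delete : ∀ {n} {G G′ : Graph n} {S S′} (e : Embedding G S G′ S′) {v} → v ∈ S →
  Embedding G (S - v) G′ (S′ - Embedding.to e v)
embedding-delete {S = S} {S′} e {v} v∈ = record
  { to = to
  ; to-∈ = λ u∈ → x∈p∧x≢y⇒x∈p-y (to-∈ (p─q⊆p S _ u∈)) (λ eq → x∉p-x S v (subst (_∈ S - v) (to-inj (p─q⊆p S _ u∈) v∈ eq) u∈))
  ; to-inj = λ u∈ w∈ → to-inj (p─q⊆p S _ u∈) (p─q⊆p S _ w∈)
  ; to-adj = λ u∈ w∈ → to-adj (p─q⊆p S _ u∈) (p─q⊆p S _ w∈)
  }
  where open Embedding e

*-≢0ˡ : ∀ {m} k → m * k ≢ 0 → m ≢ 0
*-≢0ˡ k ≢0 refl = ≢0 refl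

-- An embedding of `S` restricts to one of `S - v` into `S′ - to v`. This keeps `deletions` within
-- the functions that decks can compare.
monotone-deletions : ∀ {n} {F : Graph n → Subset n → ℕ} → Monotone F → Monotone (λ G → deletions (F G))
monotone-deletions {n} {F} mono {G} {G′} {S} {S′} e =
  sumL-inject _≟ᶠ_ _ _ to (Unique.allFin⁺ n) into
    (λ u v p q → to-inj (support p) (support q))
  where
  open Embedding e
  support : ∀ {v} → ind (v ∈? S) * F G (S - v) ≢ 0 → v ∈ S
  support {v} ≢0 = ind-≢0 (v ∈? S) (*-≢0ˡ _ ≢0)
  into : ∀ v → ind (v ∈? S) * F G (S - v) ≢ 0 →
    to v ∈ᴸ allFin n × ind (v ∈? S) * F G (S - v) ≤ ind (to v ∈? S′) * F G′ (S′ - to v)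
  into v ≢0 = ∈-allFin _ , *-mono-≤ (ind-mono (v ∈? S) (to v ∈? S′) to-∈) (mono (embedding-delete e (support ≢0)))

monotone-deck : ∀ {n ℓ} {F : Graph n → Subset n → ℕ} {G G′ : Graph n} → Monotone F → DeckEmbedding ℓ G G′ →
  total (F G) ℓ ≤ total (F G′) ℓ
monotone-deck {n} {ℓ} {F} {G} {G′} mono d = ≤-trans (≤-reflexive (guard G)) (≤-trans le (≤-reflexive (sym (guard G′))))
  where
  open DeckEmbedding d
  size : ∀ S → Dec (∣ S ∣ ≡ ℓ)
  size S = ∣ S ∣ ≟ ℓ
  -- The factor makes the function vanish away from ℓ-subsets, where nothing is known about `card`.
  guarded : Graph n → Subset n → ℕ
  guarded G S = ind (size S) * F G S
  guard : ∀ G → total (F G) ℓ ≡ total (guarded G) ℓ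
  guard G = total-cong ℓ λ S eq → sym (trans (cong (_* F G S) (ind-yes (size S) eq)) (+-identityʳ _))
  support : ∀ S → guarded G S ≢ 0 → ∣ S ∣ ≡ ℓ
  support S ≢0 = ind-≢0 (size S) (*-≢0ˡ _ ≢0)
  le : total (guarded G) ℓ ≤ total (guarded G′) ℓ
  le = sumL-inject (Vec.≡-dec _≟ᵇ_) _ _ card (subsets-unique n ℓ)
    (λ S ≢0 → subst (λ k → card S ∈ᴸ subsets n k) (card-size S (support S ≢0)) (subsets-complete (card S)) ,
      *-mono-≤ (ind-mono (size S) (size (card S)) (card-size S)) (mono (card-emb S (support S ≢0))))
    (λ S T p q → card-inj (support S p) (support T q))

DeckEqual : ∀ {n} → ℕ → Graph n → Graph n → Set
DeckEqual {n} k G G′ = ∀ (F : Graph n → Subset n → ℕ) → Monotone F → total (F G) k ≡ total (F G′) k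

-- By `total-deletions`, the total of `deletions (F G)` over (k + 1)-subsets is n - k times the
-- total of `F G` over k-subsets, and n - k is positive. `DeckEqual` ranges over all monotone
-- functions precisely so that it can be applied to `deletions`.
deckEqual-pred : ∀ {n k} {G G′ : Graph n} → k < n → DeckEqual (suc k) G G′ → DeckEqual k G G′
deckEqual-pred {n} {k} {G} {G′} k<n eq F mono = *-cancelˡ-≡ _ _ (n ∸ k) {{>-nonZero (m<n⇒0<n∸m k<n)}}
  (trans (sym (count G)) (trans (eq (λ G → deletions (F G)) (monotone-deletions mono)) (count G′)))
  where
  count : ∀ G → total (deletions (F G)) (suc k) ≡ (n ∸ k) * total (F G) k
  count G = trans (sym (m+n∸n≡m _ (k * total (F G) k)))
    (trans (cong (_∸ k * total (F G) k) (total-deletions (F G) k)) (sym (*-distribʳ-∸ (total (F G) k) n k)))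

deckEqual-≤ : ∀ {n ℓ} {G G′ : Graph n} → ℓ ≤ n → DeckEqual ℓ G G′ → ∀ k → k ≤ ℓ → DeckEqual k G G′
deckEqual-≤ {n} {ℓ} {G} {G′} ℓ≤n eq k k≤ℓ = go (≤⇒≤′ k≤ℓ) ℓ≤n eq
  where
  go : ∀ {ℓ} → k ≤′ ℓ → ℓ ≤ n → DeckEqual ℓ G G′ → DeckEqual k G G′
  go (≤′-reflexive refl) le eq = eq
  go (≤′-step k≤′) le eq = go k≤′ (<⇒≤ le) (deckEqual-pred le eq)

deckDetermined : ∀ {n ℓ} {G G′ : Graph n} → ℓ ≤ n → DeckEmbedding ℓ G G′ → DeckEmbedding ℓ G′ G →
  (F : Graph n → Subset n → ℕ) → Monotone F →
  Divisible (n ∸ ℓ) (F G) → Divisible (n ∸ ℓ) (F G′) → F G ⊤ ≡ F G′ ⊤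
deckDetermined {n} {ℓ} ℓ≤n d d′ F mono div div′ = divisible-determined (n ∸ ℓ) ℓ (m∸n+n≡m ℓ≤n) div div′
  (λ k k≤ℓ → deckEqual-≤ ℓ≤n (λ F mono → ≤-antisym (monotone-deck mono d) (monotone-deck mono d′)) k k≤ℓ F mono)

-- Deep edges and their locality

Adj-sym : ∀ {n} (G : Graph n) {u v} → Adj G u v → Adj G v u
Adj-sym G {u} {v} uv = trans (adj-sym G v u) uv

adj? : ∀ {n} (G : Graph n) u v → Dec (Adj G u v)
adj? G u v = adj G u v ≟ᵇ true

module _ {n} {P : Fin n → Set} (P? : ∀ x → Dec (P x)) where

  comprehension : Subset n
  comprehension = Vec.tabulate (λ x → does (P? x))

  ∈-comprehension⁺ : ∀ {x} → P x → x ∈ comprehension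
  ∈-comprehension⁺ {x} p = Vec.lookup⇒[]= x _ (trans (Vec.lookup∘tabulate _ x) (dec-true (P? x) p))

  ∈-comprehension⁻ : ∀ {x} → x ∈ comprehension → P x
  ∈-comprehension⁻ {x} x∈ = does-true (P? x) (trans (sym (Vec.lookup∘tabulate (does ∘ P?) x)) (Vec.[]=⇒lookup x∈))

module _ {n} (E : Fin n → Fin n → Set) (A : Fin n → Set) where

  -- Distance at most k to the set `A`. The relation `E` is a parameter because distances are also
  -- measured inside a vertex subset.
  Near : ℕ → Fin n → Set
  Near zero x = A x
  Near (suc k) x = Near k x ⊎ ∃ λ w → E x w × Near k w

  near-mono : ∀ {j k x} → j ≤ k → Near j x → Near k x
  near-mono {k = zero} z≤n near = near
  near-mono {k = suc k} z≤n near = inj₁ (near-mono {k = k} z≤n near)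
  near-mono (s≤s j≤k) (inj₁ near) = inj₁ (near-mono j≤k near)
  near-mono (s≤s j≤k) (inj₂ (w , e , near)) = inj₂ (w , e , near-mono j≤k near)

  near? : (∀ x y → Dec (E x y)) → (∀ x → Dec (A x)) → ∀ k x → Dec (Near k x)
  near? E? A? zero x = A? x
  near? E? A? (suc k) x = near? E? A? k x ⊎-dec any? (λ w → E? x w ×-dec near? E? A? k w)

near-map : ∀ {n} {E F : Fin n → Fin n → Set} {A B : Fin n → Set} (f : Fin n → Fin n) →
  (∀ {x y} → E x y → F (f x) (f y)) → (∀ {x} → A x → B (f x)) → ∀ k {x} → Near E A k x → Near F B k (f x)
near-map f E⇒F A⇒B zero near = A⇒B near
near-map f E⇒F A⇒B (suc k) (inj₁ near) = inj₁ (near-map f E⇒F A⇒B k near)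
near-map f E⇒F A⇒B (suc k) (inj₂ (w , e , near)) = inj₂ (f w , E⇒F e , near-map f E⇒F A⇒B k near)

nearVertex? : ∀ {n} (G : Graph n) k v x → Dec (Near (Adj G) (_≡ v) k x)
nearVertex? G k v = near? _ _ (adj? G) (_≟ᶠ v) k

ball : ∀ {n} → Graph n → ℕ → Fin n → Subset n
ball G k v = comprehension (nearVertex? G k v)

module _ {n} (G : Graph n) (S : Subset n) where

  -- Nonbacktracking walks of r edges in S that start at u and do not step to x first.
  Ray : ℕ → Fin n → Fin n → Set
  Ray zero u x = Unit.⊤
  Ray (suc r) u x = ∃ λ w → w ∈ S × Adj G u w × w ≢ x × Ray r w u

  ray? : ∀ r u x → Dec (Ray r u x)
  ray? zero u x = yes _
  ray? (suc r) u x = any? λ w → w ∈? S ×-dec adj? G u w ×-dec ¬? (w ≟ᶠ x) ×-dec ray? r w u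

  ray-pred : ∀ r {u x} → Ray (suc r) u x → Ray r u x
  ray-pred zero _ = _
  ray-pred (suc r) (w , w∈ , uw , w≢x , ray) = w , w∈ , uw , w≢x , ray-pred r ray

  -- uv is the middle edge of a nonbacktracking walk of 2r + 1 edges in S.
  Deep : ℕ → Fin n → Fin n → Set
  Deep r u v = u ∈ S × v ∈ S × Adj G u v × Ray r u v × Ray r v u

  deep? : ∀ r u v → Dec (Deep r u v)
  deep? r u v = u ∈? S ×-dec v ∈? S ×-dec adj? G u v ×-dec ray? r u v ×-dec ray? r v u

  deep-sym : ∀ r {u v} → Deep r u v → Deep r v u
  deep-sym r (u∈ , v∈ , uv , ray , ray′) = v∈ , u∈ , Adj-sym G uv , ray′ , ray

  deepVertex? : ∀ r v → Dec (∃ (Deep r v))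
  deepVertex? r v = any? (deep? r v)

  deepVertices : ℕ → ℕ
  deepVertices r = sumF (λ v → ind (deepVertex? r v))

  -- Pairs are ordered, so each deep edge counts twice. For `r = 0` this is twice the number of
  -- edges inside `S`.
  deepPairs : ℕ → ℕ
  deepPairs r = sumF (λ u → sumF (λ v → ind (deep? r u v)))

module _ {n} {G G′ : Graph n} {S S′ : Subset n} (e : Embedding G S G′ S′) where
  open Embedding e

  to-Adj : ∀ {u v} → u ∈ S → v ∈ S → Adj G u v → Adj G′ (to u) (to v)
  to-Adj u∈ v∈ uv = trans (sym (to-adj u∈ v∈)) uv

  ray-embed : ∀ r {u x} → u ∈ S → x ∈ S → Ray G S r u x → Ray G′ S′ r (to u) (to x)
  ray-embed zero u∈ x∈ _ = _
  ray-embed (suc r) u∈ x∈ (w , w∈ , uw , w≢x , ray) =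
    to w , to-∈ w∈ , to-Adj u∈ w∈ uw , (λ eq → w≢x (to-inj w∈ x∈ eq)) , ray-embed r w∈ u∈ ray

  deep-embed : ∀ r {u v} → Deep G S r u v → Deep G′ S′ r (to u) (to v)
  deep-embed r (u∈ , v∈ , uv , ray , ray′) =
    to-∈ u∈ , to-∈ v∈ , to-Adj u∈ v∈ uv , ray-embed r u∈ v∈ ray , ray-embed r v∈ u∈ ray′

deepVertices-monotone : ∀ {n} r → Monotone {n} (λ G S → deepVertices G S r)
deepVertices-monotone {n} r {G} {G′} {S} {S′} e = sumL-inject _≟ᶠ_ _ _ to (Unique.allFin⁺ n)
  (λ v _ → ∈-allFin _ , ind-mono (deepVertex? G S r v) (deepVertex? G′ S′ r (to v)) (λ (u , deep) → to u , deep-embed e r deep))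
  (λ u v p q → to-inj (support u p) (support v q))
  where
  open Embedding e
  support : ∀ v → ind (deepVertex? G S r v) ≢ 0 → v ∈ S
  support v ≢0 = proj₁ (proj₂ (ind-≢0 (deepVertex? G S r v) ≢0))

deepPairs-monotone : ∀ {n} r → Monotone {n} (λ G S → deepPairs G S r)
deepPairs-monotone {n} r {G} {G′} {S} {S′} e = sumL-inject _≟ᶠ_ _ _ to (Unique.allFin⁺ n)
  (λ u _ → ∈-allFin _ , sumL-inject _≟ᶠ_ _ _ to (Unique.allFin⁺ n)
    (λ v _ → ∈-allFin _ , ind-mono (deep? G S r u v) (deep? G′ S′ r (to u) (to v)) (deep-embed e r))
    (λ v w p q → to-inj (support₂ {u} p) (support₂ {u} q)))
  (λ u v p q → to-inj (support₁ p) (support₁ q))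
  where
  open Embedding e
  support₂ : ∀ {u v} → ind (deep? G S r u v) ≢ 0 → v ∈ S
  support₂ {u} {v} ≢0 = proj₁ (proj₂ (ind-≢0 (deep? G S r u v) ≢0))
  support₁ : ∀ {u} → sumF (λ v → ind (deep? G S r u v)) ≢ 0 → u ∈ S
  support₁ {u} ≢0 with sumL-≢0 (allFin n) (λ v → ind (deep? G S r u v)) ≢0
  ... | v , ≢0′ = proj₁ (ind-≢0 (deep? G S r u v) ≢0′)

∩-agree : ∀ {n} {S S′ B : Subset n} → S ∩ B ≡ S′ ∩ B → ∀ {x} → x ∈ B → x ∈ S → x ∈ S′
∩-agree {S = S} {S′} {B} eq x∈B x∈S = proj₁ (x∈p∩q⁻ S′ B (subst (_ ∈_) eq (x∈p∩q⁺ (x∈S , x∈B))))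

module _ {n} (G : Graph n) {S S′ : Subset n} where

  -- Every step of the ray raises the distance bound `i` by at most one, so `i + r ≤ R` keeps the
  -- ray inside the ball, where `S` and `S′` agree.
  ray-local : ∀ {R v} → S ∩ ball G R v ≡ S′ ∩ ball G R v → ∀ r {i w x} → i + r ≤ R →
    Near (Adj G) (_≡ v) i w → Ray G S r w x → Ray G S′ r w x
  ray-local eq zero le near _ = _
  ray-local {R} {v} eq (suc r) {i} {w} le near (w′ , w′∈ , ww′ , w′≢x , ray) =
    w′ , ∩-agree eq (∈-comprehension⁺ (nearVertex? G R v) (near-mono _ _ (≤-trans (m≤m+n (suc i) r) le′) near′)) w′∈ ,
    ww′ , w′≢x , ray-local eq r le′ near′ ray
    where
    le′ : suc i + r ≤ R
    le′ = subst (_≤ R) (+-suc i r) le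
    near′ : Near (Adj G) (_≡ v) (suc i) w′
    near′ = inj₂ (w , Adj-sym G ww′ , near)

  -- The ray from `u` stays within distance r of `u`; the ray from its neighbour `v` may reach
  -- distance r + 1, which fixes the radius.
  deep-local : ∀ r {u v} → S ∩ ball G (suc r) u ≡ S′ ∩ ball G (suc r) u → Deep G S r u v → Deep G S′ r u v
  deep-local r {u} {v} eq (u∈ , v∈ , uv , ray , ray′) =
    ∩-agree eq (inBall {0} z≤n refl) u∈ , ∩-agree eq (inBall {1} (s≤s z≤n) near-v) v∈ , uv ,
    ray-local eq r {0} (n≤1+n r) refl ray , ray-local eq r {1} ≤-refl near-v ray′
    where
    near-v : Near (Adj G) (_≡ u) 1 v
    near-v = inj₂ (u , Adj-sym G uv , refl)
    inBall : ∀ {i x} → i ≤ suc r → Near (Adj G) (_≡ u) i x → x ∈ ball G (suc r) u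
    inBall le near = ∈-comprehension⁺ (nearVertex? G (suc r) u) (near-mono _ _ le near)

  -- For edges the two ends replace the ball, so that edge counts do not rest on a bound for the
  -- degrees.
  adjacent-local : ∀ {u v} → S ∩ (⁅ u ⁆ ∪ ⁅ v ⁆) ≡ S′ ∩ (⁅ u ⁆ ∪ ⁅ v ⁆) → Deep G S 0 u v → Deep G S′ 0 u v
  adjacent-local {u} {v} eq (u∈ , v∈ , uv , _) =
    ∩-agree eq (x∈p∪q⁺ (inj₁ (x∈⁅x⁆ u))) u∈ , ∩-agree eq (x∈p∪q⁺ (inj₂ (x∈⁅x⁆ v))) v∈ , uv , _

module _ {n} (G : Graph n) {t : ℕ} where

  deepVertices-divisible : ∀ r → (∀ v → ∣ ball G (suc r) v ∣ + t ≤ n) → Divisible t (λ S → deepVertices G S r)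
  deepVertices-divisible r small = divisible-sum t (allFin n) _ λ v →
    divisible-dependsOn t (ball G (suc r) v) _ (λ S S′ eq → ind-cong (deepVertex? G S r v) (deepVertex? G S′ r v)
      (λ (u , deep) → u , deep-local G r eq deep) (λ (u , deep) → u , deep-local G r (sym eq) deep)) (small v)

  deepPairs-divisible : ∀ r → (∀ v → ∣ ball G (suc r) v ∣ + t ≤ n) → Divisible t (λ S → deepPairs G S r)
  deepPairs-divisible r small = divisible-sum t (allFin n) _ λ u → divisible-sum t (allFin n) _ λ v →
    divisible-dependsOn t (ball G (suc r) u) _ (λ S S′ eq → ind-cong (deep? G S r u v) (deep? G S′ r u v)
      (deep-local G r eq) (deep-local G r (sym eq))) (small u)

  edges-divisible : (∀ u v → ∣ ⁅ u ⁆ ∪ ⁅ v ⁆ ∣ + t ≤ n) → Divisible t (λ S → deepPairs G S 0)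
  edges-divisible small = divisible-sum t (allFin n) _ λ u → divisible-sum t (allFin n) _ λ v →
    divisible-dependsOn t (⁅ u ⁆ ∪ ⁅ v ⁆) _ (λ S S′ eq → ind-cong (deep? G S 0 u v) (deep? G S′ 0 u v)
      (adjacent-local G eq) (adjacent-local G (sym eq))) (small u v)

-- Nonbacktracking walks, cycles and forests

module _ {A : Set} (d : A) where

  nth : List A → ℕ → A
  nth [] k = d
  nth (x ∷ xs) zero = x
  nth (x ∷ xs) (suc k) = nth xs k

  nth-∈ : ∀ xs {k} → k < length xs → nth xs k ∈ᴸ xs
  nth-∈ (x ∷ xs) {zero} lt = here refl
  nth-∈ (x ∷ xs) {suc k} (s≤s lt) = there (nth-∈ xs lt)

  ∈⇒nth : ∀ {x xs} → x ∈ᴸ xs → ∃ λ k → k < length xs × nth xs k ≡ x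
  ∈⇒nth (here refl) = zero , s≤s z≤n , refl
  ∈⇒nth (there x∈) with ∈⇒nth x∈
  ... | k , lt , eq = suc k , s≤s lt , eq

  nth-injective : ∀ {xs} → Unique xs → ∀ {i j} → i < length xs → j < length xs → nth xs i ≡ nth xs j → i ≡ j
  nth-injective (x∉ ∷ u) {zero} {zero} i< j< eq = refl
  nth-injective (x∉ ∷ u) {zero} {suc j} i< (s≤s j<) eq = ⊥-elim (All.lookup x∉ (nth-∈ _ j<) eq)
  nth-injective (x∉ ∷ u) {suc i} {zero} (s≤s i<) j< eq = ⊥-elim (All.lookup x∉ (nth-∈ _ i<) (sym eq))
  nth-injective (x∉ ∷ u) {suc i} {suc j} (s≤s i<) (s≤s j<) eq = cong suc (nth-injective u i< j< eq)

unique-length : ∀ {n} {xs} (S : Subset n) → Unique xs → (∀ {x} → x ∈ᴸ xs → x ∈ S) → length xs ≤ ∣ S ∣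
unique-length S [] ⊆S = z≤n
unique-length {xs = x ∷ xs} S (x∉ ∷ u) ⊆S = ≤-<-trans
  (unique-length (S - x) u (λ y∈ → x∈p∧x≢y⇒x∈p-y (⊆S (there y∈)) (λ eq → All.lookup x∉ y∈ (sym eq))))
  (x∈p⇒∣p-x∣<∣p∣ (⊆S (here refl)))

unique-length-≤ : ∀ {n} {xs : List (Fin n)} → Unique xs → length xs ≤ n
unique-length-≤ {n} u = ≤-trans (unique-length ⊤ u (λ _ → ∈⊤)) (≤-reflexive (∣⊤∣≡n n))

adj-≢ : ∀ {n} (G : Graph n) {u v} → Adj G u v → u ≢ v
adj-≢ G {u} uv refl = case trans (sym uv) (adj-irrefl G u) of λ ()

cycleLength : ∀ {n} {G : Graph n} → Cycle G → ℕ
cycleLength C = 3 + Cycle.m C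

data Nonbacktracking {n} (G : Graph n) : List (Fin n) → Set where
  single : ∀ {x} → Nonbacktracking G (x ∷ [])
  edge   : ∀ {x y} → Adj G x y → Nonbacktracking G (x ∷ y ∷ [])
  turn   : ∀ {x y z zs} → Adj G x y → x ≢ z → Nonbacktracking G (y ∷ z ∷ zs) → Nonbacktracking G (x ∷ y ∷ z ∷ zs)

module _ {n} {G : Graph n} where
  open DecMembership (_≟ᶠ_ {n}) using () renaming (_∈?_ to _∈ᴸ?_)

  nb-nth : ∀ d {xs} → Nonbacktracking G xs → ∀ k → suc k < length xs → Adj G (nth d xs k) (nth d xs (suc k))
  nb-nth d single k (s≤s ())
  nb-nth d (edge xy) zero lt = xy
  nb-nth d (edge xy) (suc k) (s≤s (s≤s ()))
  nb-nth d (turn xy _ nb) zero lt = xy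
  nb-nth d (turn xy _ nb) (suc k) (s≤s lt) = nb-nth d nb k lt

  nb-tail : ∀ {x y ys} → Nonbacktracking G (x ∷ y ∷ ys) → Nonbacktracking G (y ∷ ys)
  nb-tail (edge _) = single
  nb-tail (turn _ _ nb) = nb

  cycleOf : (f : ℕ → Fin n) (m : ℕ) → (∀ k → k < 2 + m → Adj G (f k) (f (suc k))) → Adj G (f (2 + m)) (f 0) →
    (∀ i j → i ≤ 2 + m → j ≤ 2 + m → f i ≡ f j → i ≡ j) → Cycle G
  cycleOf f m consecutive closing injective = record
    { m = m
    ; c = f ∘ toℕ
    ; inj = λ {i} {j} eq → toℕ-injective (injective _ _ (toℕ≤pred[n] i) (toℕ≤pred[n] j) eq)
    ; edges = λ i → subst (λ k → Adj G (f k) (f (suc (toℕ i)))) (sym (toℕ-inject₁ i)) (consecutive (toℕ i) (toℕ<n i))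
    ; close = subst (λ k → Adj G (f k) (f 0)) (sym (toℕ-fromℕ (2 + m))) closing
    }

  -- If the tail is a path and `x` recurs in it, the segment up to the recurrence is a cycle:
  -- recurrence at position 0 would be a loop, and at position 1 a backtrack. The length bound lets
  -- short walks be compared with long cycles.
  nb-unique⊎cycle : ∀ {xs} → Nonbacktracking G xs → Unique xs ⊎ (Σ (Cycle G) λ C → cycleLength C < length xs)
  nb-unique⊎cycle single = inj₁ ([] ∷ [])
  nb-unique⊎cycle (edge xy) = inj₁ ((adj-≢ G xy ∷ []) ∷ [] ∷ [])
  nb-unique⊎cycle {x ∷ xs@(y ∷ z ∷ zs)} (turn xy x≢z nb) with nb-unique⊎cycle nb
  ... | inj₂ (C , lt) = inj₂ (C , <-trans lt (n<1+n _))
  ... | inj₁ u with x ∈ᴸ? xs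
  ...   | no x∉ = inj₁ (¬Any⇒All¬ xs x∉ ∷ u)
  ...   | yes x∈ with ∈⇒nth x x∈
  ...     | zero , _ , eq = ⊥-elim (adj-≢ G xy (sym eq))
  ...     | suc zero , _ , eq = ⊥-elim (x≢z (sym eq))
  -- Entry 3 + m of `x ∷ xs` is `x` again, so the entries 0 to 2 + m form a cycle of length 3 + m.
  ...     | suc (suc m) , lt , eq = inj₂ (cycleOf f m consecutive closing injective , s≤s lt)
    where
    f : ℕ → Fin n
    f = nth x (x ∷ xs)
    consecutive′ : ∀ k → k < 3 + m → Adj G (f k) (f (suc k))
    consecutive′ k k< = nb-nth x (turn xy x≢z nb) k (≤-trans (s≤s k<) (s≤s lt))
    consecutive : ∀ k → k < 2 + m → Adj G (f k) (f (suc k))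
    consecutive k k< = consecutive′ k (m≤n⇒m≤1+n k<)
    closing : Adj G (f (2 + m)) x
    closing = subst (Adj G (f (2 + m))) eq (consecutive′ (2 + m) ≤-refl)
    injective : ∀ i j → i ≤ 2 + m → j ≤ 2 + m → f i ≡ f j → i ≡ j
    injective zero zero _ _ _ = refl
    injective zero (suc j) _ j≤ e = ⊥-elim (<-irrefl (nth-injective x u (<-trans j≤ lt) lt (trans (sym e) (sym eq))) j≤)
    injective (suc i) zero i≤ _ e = ⊥-elim (<-irrefl (nth-injective x u (<-trans i≤ lt) lt (trans e (sym eq))) i≤)
    injective (suc i) (suc j) i≤ j≤ e = cong suc (nth-injective x u (<-trans i≤ lt) (<-trans j≤ lt) e)

  acyclic⇒unique : Acyclic G → ∀ {xs} → Nonbacktracking G xs → Unique xs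
  acyclic⇒unique acyclic nb with nb-unique⊎cycle nb
  ... | inj₁ u = u
  ... | inj₂ (C , _) = ⊥-elim (acyclic C)

  -- Otherwise every vertex of `S` has a neighbour in `S` different from any prescribed `y`, and
  -- nonbacktracking walks in `S` can be prolonged beyond n vertices, although acyclicity makes them
  -- paths. The vertex found may also be isolated in `S`.
  leaf : Acyclic G → ∀ (S : Subset n) {x} → x ∈ S →
    ∃₂ λ x y → x ∈ S × (∀ v → v ∈ S × Adj G x v → v ≡ y)
  leaf acyclic S {x₀} x₀∈ with any? (λ x → any? (λ y → x ∈? S ×-dec all? (λ v → (v ∈? S ×-dec adj? G x v) →-dec v ≟ᶠ y)))
  ... | yes (x , y , x∈ , only) = x , y , x∈ , only
  ... | no none = ⊥-elim (too-long (long n))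
    where
    next : ∀ {x} y → x ∈ S → ∃ λ v → v ∈ S × Adj G v x × v ≢ y
    next {x} y x∈ with ¬∀⟶∃¬ n _ (λ v → (v ∈? S ×-dec adj? G x v) →-dec v ≟ᶠ y) (λ only → none (x , y , x∈ , only))
    ... | v , ¬imp with decidable-stable (v ∈? S ×-dec adj? G x v) (λ ¬p → ¬imp (λ p → ⊥-elim (¬p p)))
    ...   | v∈ , xv = v , v∈ , Adj-sym G xv , (λ eq → ¬imp (λ _ → eq))
    long : ∀ k → ∃₂ λ x y → ∃ λ zs → x ∈ S × Nonbacktracking G (x ∷ y ∷ zs) × k ≤ length zs
    long zero with next x₀ x₀∈
    ... | y , y∈ , yx , _ = y , x₀ , [] , y∈ , edge yx , z≤n
    long (suc k) with long k
    ... | x , y , zs , x∈ , nb , le with next y x∈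
    ...   | v , v∈ , vx , v≢y = v , x , y ∷ zs , v∈ , turn vx v≢y nb , s≤s le
    too-long : (∃₂ λ x y → ∃ λ zs → x ∈ S × Nonbacktracking G (x ∷ y ∷ zs) × n ≤ length zs) → ⊥
    too-long (x , y , zs , _ , nb , le) =
      <-irrefl refl (≤-trans (s≤s (m≤n⇒m≤1+n le)) (unique-length-≤ (acyclic⇒unique acyclic nb)))

-- Cardinalities as sums, double sums and orientations

∣∣-sum : ∀ {n} (S : Subset n) → ∣ S ∣ ≡ sumF (λ v → ind (v ∈? S))
∣∣-sum [] = refl
∣∣-sum (true ∷ S) = trans (cong suc (∣∣-sum S)) (sym (sumF-suc (λ v → ind (v ∈? (true ∷ S)))))
∣∣-sum (false ∷ S) = trans (∣∣-sum S) (sym (sumF-suc (λ v → ind (v ∈? (false ∷ S)))))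

∣comprehension∣ : ∀ {n} {P : Fin n → Set} (P? : ∀ x → Dec (P x)) → ∣ comprehension P? ∣ ≡ sumF (λ v → ind (P? v))
∣comprehension∣ {n} P? = trans (∣∣-sum (comprehension P?)) (sumL-cong (allFin n) (λ v →
  ind-cong (v ∈? comprehension P?) (P? v) (∈-comprehension⁻ P?) (∈-comprehension⁺ P?)))

sumF₂ : ∀ {n} → (Fin n → Fin n → ℕ) → ℕ
sumF₂ f = sumF (λ u → sumF (f u))

sumF₂-mono : ∀ {n} {f g : Fin n → Fin n → ℕ} → (∀ u v → f u v ≤ g u v) → sumF₂ f ≤ sumF₂ g
sumF₂-mono {n} le = sumL-mono (allFin n) (λ u → sumL-mono (allFin n) (le u))

sumF₂-+ : ∀ {n} (f g : Fin n → Fin n → ℕ) → sumF₂ (λ u v → f u v + g u v) ≡ sumF₂ f + sumF₂ g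
sumF₂-+ {n} f g = trans (sumL-cong (allFin n) (λ u → sumL-+ (allFin n) (f u) (g u)))
  (sumL-+ (allFin n) (λ u → sumF (f u)) (λ u → sumF (g u)))

sumF₂-graph : ∀ {n} {X : Fin n → Set} (X? : ∀ v → Dec (X v)) (p : Fin n → Fin n) →
  sumF₂ (λ u v → ind (X? u ×-dec p u ≟ᶠ v)) ≡ sumF (λ u → ind (X? u))
sumF₂-graph {n} X? p = sumL-cong (allFin n) λ u → trans
  (sumF-single (λ v → ind (X? u ×-dec p u ≟ᶠ v)) (p u) (λ v ≢0 → sym (proj₂ (ind-≢0 (X? u ×-dec p u ≟ᶠ v) ≢0))))
  (ind-cong (X? u ×-dec p u ≟ᶠ p u) (X? u) proj₁ (_, refl))

-- Each v in X claims the edge between v and p v, and no edge is claimed from both ends.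
orientation : ∀ {n} {X : Fin n → Set} {Q : Fin n → Fin n → Set} (X? : ∀ v → Dec (X v)) (Q? : ∀ u v → Dec (Q u v))
  (p : Fin n → Fin n) → (∀ {v} → X v → Q v (p v)) → (∀ {u v} → Q u v → Q v u) → (∀ {v} → X v → p (p v) ≢ v) →
  sumF (λ v → ind (X? v)) + sumF (λ v → ind (X? v)) ≤ sumF₂ (λ u v → ind (Q? u v))
orientation {n} {X} {Q} X? Q? p claim Q-sym pp≢ = ≤-trans (≤-reflexive (sym (trans (sumF₂-+ f g)
    (cong₂ _+_ (sumF₂-graph X? p) (trans (sumL-comm (allFin n) (allFin n) g) (sumF₂-graph X? p)))))) (sumF₂-mono le)
  where
  f g : Fin n → Fin n → ℕ
  f u v = ind (X? u ×-dec p u ≟ᶠ v)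
  g u v = ind (X? v ×-dec p v ≟ᶠ u)
  le : ∀ u v → f u v + g u v ≤ ind (Q? u v)
  le u v = ind-exclusive (X? u ×-dec p u ≟ᶠ v) (X? v ×-dec p v ≟ᶠ u) (Q? u v)
    (λ { (xu , refl) → claim xu }) (λ { (xv , refl) → Q-sym (claim xv) }) (λ { (xu , refl) (_ , eq) → pp≢ xu eq })

walk-++ : ∀ {n} {G : Graph n} {u v w} → Walk G u v → Walk G v w → Walk G u w
walk-++ here q = q
walk-++ (step uv p) q = step uv (walk-++ p q)

-- Counting the edges of a forest

module _ {n} (G : Graph n) (acyclic : Acyclic G) where

  private
    e : Subset n → ℕ
    e S = deepPairs G S 0

  -- Only the ordered pairs (x , y) and (y , x) can be lost; `f` and its transpose mark them.
  leaf-removal : ∀ {S x y} → (∀ v → v ∈ S × Adj G x v → v ≡ y) → e S ≤ e (S - x) + 2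
  leaf-removal {S} {x} {y} only = begin
    e S ≤⟨ sumF₂-mono le ⟩
    sumF₂ (λ u v → ind (deep? G (S - x) 0 u v) + (f u v + f v u))
      ≡⟨ sumF₂-+ (λ u v → ind (deep? G (S - x) 0 u v)) (λ u v → f u v + f v u) ⟩
    e (S - x) + sumF₂ (λ u v → f u v + f v u) ≡⟨ cong (e (S - x) +_) (sumF₂-+ f (λ u v → f v u)) ⟩
    e (S - x) + (sumF₂ f + sumF₂ (λ u v → f v u))
      ≡⟨ cong (e (S - x) +_) (cong₂ _+_ one (trans (sumL-comm (allFin n) (allFin n) (λ u v → f v u)) one)) ⟩
    e (S - x) + 2 ∎
    where
    open ≤-Reasoning
    f : Fin n → Fin n → ℕ
    f u v = ind (u ≟ᶠ x ×-dec y ≟ᶠ v)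
    one : sumF₂ f ≡ 1
    one = trans (sumF₂-graph (_≟ᶠ x) (λ _ → y)) (trans (sumF-single (λ u → ind (u ≟ᶠ x)) x (λ u ≢0 → ind-≢0 (u ≟ᶠ x) ≢0))
      (ind-yes (x ≟ᶠ x) refl))
    le : ∀ u v → ind (deep? G S 0 u v) ≤ ind (deep? G (S - x) 0 u v) + (f u v + f v u)
    le u v = ind-≤ (deep? G S 0 u v) λ (u∈ , v∈ , uv , _) → cases u∈ v∈ uv (u ≟ᶠ x) (v ≟ᶠ x)
      where
      cases : u ∈ S → v ∈ S → Adj G u v → Dec (u ≡ x) → Dec (v ≡ x) → 1 ≤ ind (deep? G (S - x) 0 u v) + (f u v + f v u)
      cases u∈ v∈ uv (yes refl) _ = ≤-trans (≤-trans (≤-reflexive (sym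
        (ind-yes (x ≟ᶠ x ×-dec y ≟ᶠ v) (refl , sym (only v (v∈ , uv)))))) (m≤m+n _ (f v x)))
        (m≤n+m _ (ind (deep? G (S - x) 0 x v)))
      cases u∈ v∈ uv (no _) (yes refl) = ≤-trans (≤-trans (≤-reflexive (sym
        (ind-yes (x ≟ᶠ x ×-dec y ≟ᶠ u) (refl , sym (only u (u∈ , Adj-sym G uv)))))) (m≤n+m _ (f u x)))
        (m≤n+m _ (ind (deep? G (S - x) 0 u x)))
      cases u∈ v∈ uv (no u≢x) (no v≢x) = ≤-trans (≤-reflexive (sym (ind-yes (deep? G (S - x) 0 u v)
        (x∈p∧x≢y⇒x∈p-y u∈ u≢x , x∈p∧x≢y⇒x∈p-y v∈ v≢x , uv , _)))) (m≤m+n _ _)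

  isolated-removal : ∀ {S x} → (∀ v → ¬ (v ∈ S × Adj G x v)) → e S ≤ e (S - x)
  isolated-removal {S} {x} isolated = sumF₂-mono λ u v → ind-mono (deep? G S 0 u v) (deep? G (S - x) 0 u v)
    λ (u∈ , v∈ , uv , _) →
      x∈p∧x≢y⇒x∈p-y u∈ (λ { refl → isolated v (v∈ , uv) }) ,
      x∈p∧x≢y⇒x∈p-y v∈ (λ { refl → isolated u (u∈ , Adj-sym G uv) }) , uv , _

  -- Leaves are removed one at a time, with `k` as the induction measure. Since `e` counts ordered
  -- pairs, the bounds read edges + 1 ≤ vertices and edges + 2 ≤ vertices. Removing an isolated
  -- vertex while others remain produces the stronger bound; removing a leaf with its edge preserves
  -- whichever alternative holds.
  forest : ∀ k S → ∣ S ∣ ≤ k → ∀ {x} → x ∈ S →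
    e S + 2 ≤ ∣ S ∣ + ∣ S ∣ × (e S + 4 ≤ ∣ S ∣ + ∣ S ∣ ⊎ (∀ {u v} → u ∈ S → v ∈ S → Walk G u v))
  forest zero S le x∈ = ⊥-elim (<-irrefl refl (≤-trans (≤-<-trans z≤n (x∈p⇒∣p-x∣<∣p∣ x∈)) le))
  forest (suc k) S le x₀∈ with leaf acyclic S x₀∈
  ... | x , y , x∈ , only with nonempty? (S - x)
  ...   | no empty = bound , inj₂ (λ u∈ v∈ → subst₂ (Walk G) (sym (alone u∈)) (sym (alone v∈)) here)
    where
    alone : ∀ {u} → u ∈ S → u ≡ x
    alone {u} u∈ with u ≟ᶠ x
    ... | yes eq = eq
    ... | no u≢x = ⊥-elim (empty (u , x∈p∧x≢y⇒x∈p-y u∈ u≢x))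
    e-0 : e S ≡ 0
    e-0 = n≤0⇒n≡0 (≤-trans (sumF₂-mono {g = λ _ _ → 0} (λ u v → ≤-reflexive (ind-no (deep? G S 0 u v)
      (λ (u∈ , v∈ , uv , _) → adj-≢ G uv (trans (alone u∈) (sym (alone v∈)))))))
      (≤-reflexive (trans (sumL-cong (allFin n) (λ _ → sumL-0 (allFin n))) (sumL-0 (allFin n)))))
    bound : e S + 2 ≤ ∣ S ∣ + ∣ S ∣
    bound = subst (λ j → j + 2 ≤ ∣ S ∣ + ∣ S ∣) (sym e-0) (+-mono-≤ 1≤ 1≤)
      where
      1≤ : 1 ≤ ∣ S ∣
      1≤ = ≤-<-trans z≤n (x∈p⇒∣p-x∣<∣p∣ x∈)
  ...   | yes (z , z∈) with forest k (S - x) (≤-pred (≤-trans (x∈p⇒∣p-x∣<∣p∣ x∈) le)) z∈ | y ∈? S ×-dec adj? G x y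
  ...     | fewer , fewest | no ¬xy = ≤-trans (+-monoʳ-≤ (e S) (s≤s (s≤s (z≤n {2})))) e+4 , inj₁ e+4
    where
    shrink : e S ≤ e (S - x)
    shrink = isolated-removal (λ v (v∈ , xv) → ¬xy (subst (λ w → w ∈ S × Adj G x w) (only v (v∈ , xv)) (v∈ , xv)))
    e+4 : e S + 4 ≤ ∣ S ∣ + ∣ S ∣
    e+4 = begin
      e S + 4 ≤⟨ +-monoˡ-≤ 4 shrink ⟩
      e (S - x) + 4 ≡⟨ +-assoc (e (S - x)) 2 2 ⟨
      e (S - x) + 2 + 2 ≤⟨ +-monoˡ-≤ 2 fewer ⟩
      ∣ S - x ∣ + ∣ S - x ∣ + 2 ≡⟨ pair ∣ S - x ∣ ⟩
      suc ∣ S - x ∣ + suc ∣ S - x ∣ ≤⟨ +-mono-≤ (x∈p⇒∣p-x∣<∣p∣ x∈) (x∈p⇒∣p-x∣<∣p∣ x∈) ⟩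
      ∣ S ∣ + ∣ S ∣ ∎
      where
      open ≤-Reasoning
      pair : ∀ a → a + a + 2 ≡ suc a + suc a
      pair = solve-∀
  ...     | fewer , fewest | yes (y∈ , xy) = grow 2 fewer , extendWalks fewest
    where
    grow : ∀ c → e (S - x) + c ≤ ∣ S - x ∣ + ∣ S - x ∣ → e S + c ≤ ∣ S ∣ + ∣ S ∣
    grow c le = begin
      e S + c ≤⟨ +-monoˡ-≤ c (leaf-removal only) ⟩
      e (S - x) + 2 + c ≡⟨ swap (e (S - x)) 2 c ⟩
      e (S - x) + c + 2 ≤⟨ +-monoˡ-≤ 2 le ⟩
      ∣ S - x ∣ + ∣ S - x ∣ + 2 ≡⟨ pair ∣ S - x ∣ ⟩
      suc ∣ S - x ∣ + suc ∣ S - x ∣ ≤⟨ +-mono-≤ (x∈p⇒∣p-x∣<∣p∣ x∈) (x∈p⇒∣p-x∣<∣p∣ x∈) ⟩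
      ∣ S ∣ + ∣ S ∣ ∎
      where
      open ≤-Reasoning
      swap : ∀ a b c → a + b + c ≡ a + c + b
      swap = solve-∀
      pair : ∀ a → a + a + 2 ≡ suc a + suc a
      pair = solve-∀
    y∈′ : y ∈ S - x
    y∈′ = x∈p∧x≢y⇒x∈p-y y∈ (λ eq → adj-≢ G xy (sym eq))
    extendWalks : e (S - x) + 4 ≤ ∣ S - x ∣ + ∣ S - x ∣ ⊎ (∀ {u v} → u ∈ S - x → v ∈ S - x → Walk G u v) →
      e S + 4 ≤ ∣ S ∣ + ∣ S ∣ ⊎ (∀ {u v} → u ∈ S → v ∈ S → Walk G u v)
    extendWalks (inj₁ le) = inj₁ (grow 4 le)
    extendWalks (inj₂ walks) = inj₂ λ u∈ v∈ → case (to-rest u∈ , to-rest v∈) of λ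
      { ((u′ , u′∈ , uu′ , _) , (v′ , v′∈ , _ , v′v)) → walk-++ uu′ (walk-++ (walks u′∈ v′∈) v′v) }
      where
      to-rest : ∀ {u} → u ∈ S → ∃ λ u′ → u′ ∈ S - x × Walk G u u′ × Walk G u′ u
      to-rest {u} u∈ with u ≟ᶠ x
      ... | yes refl = y , y∈′ , step xy here , step (Adj-sym G xy) here
      ... | no u≢x = u , x∈p∧x≢y⇒x∈p-y u∈ u≢x , here , here

-- Distances and balls

between : ∀ {n} {I J : Subset n} k → I ⊆ J → ∣ I ∣ ≤ k → k ≤ ∣ J ∣ → ∃ λ S → I ⊆ S × S ⊆ J × ∣ S ∣ ≡ k
between {I = []} {[]} zero I⊆J I≤ ≤J = [] , id , id , refl
between {I = true ∷ I} {false ∷ J} k I⊆J I≤ ≤J = case I⊆J here of λ ()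
between {I = true ∷ I} {true ∷ J} (suc k) I⊆J (s≤s I≤) (s≤s ≤J) with between k (drop-∷-⊆ I⊆J) I≤ ≤J
... | S , I⊆S , S⊆J , size = true ∷ S , (λ { here → here ; (there x∈) → there (I⊆S x∈) }) ,
  (λ { here → here ; (there x∈) → there (S⊆J x∈) }) , cong suc size
between {I = false ∷ I} {false ∷ J} k I⊆J I≤ ≤J with between k (drop-∷-⊆ I⊆J) I≤ ≤J
... | S , I⊆S , S⊆J , size = false ∷ S , (λ { (there x∈) → there (I⊆S x∈) }) , (λ { (there x∈) → there (S⊆J x∈) }) , size
between {I = false ∷ I} {true ∷ J} k I⊆J I≤ ≤J with k ≤? ∣ J ∣
... | no k≰J = true ∷ J , I⊆J , id , ≤-antisym (≰⇒> k≰J) ≤J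
... | yes k≤J with between k (λ x∈ → drop-there (I⊆J (there x∈))) I≤ k≤J
...   | S , I⊆S , S⊆J , size = false ∷ S , (λ { (there x∈) → there (I⊆S x∈) }) , (λ { (there x∈) → there (S⊆J x∈) }) , size

sumF-1 : ∀ n → sumF {n} (λ _ → 1) ≡ n
sumF-1 zero = refl
sumF-1 (suc n) = trans (sumF-suc {n} (λ _ → 1)) (cong suc (sumF-1 n))

module _ {k n} (q : Fin k → Fin n) where

  inImage? : ∀ x → Dec (∃ λ i → q i ≡ x)
  inImage? x = any? (λ i → q i ≟ᶠ x)

  image : Subset n
  image = comprehension inImage?

  ∈-image : ∀ i → q i ∈ image
  ∈-image i = ∈-comprehension⁺ inImage? (i , refl)

  ∣image∣≤ : ∣ image ∣ ≤ k
  ∣image∣≤ = begin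
    ∣ image ∣ ≡⟨ ∣comprehension∣ inImage? ⟩
    sumF (λ x → ind (inImage? x)) ≤⟨ sumL-mono (allFin n) (λ x → ind-≤ (inImage? x) (λ (i , eq) →
      ≤-trans (≤-reflexive (sym (ind-yes (q i ≟ᶠ x) eq))) (sumF-∈ (λ i → ind (q i ≟ᶠ x)) i))) ⟩
    sumF (λ x → sumF (λ i → ind (q i ≟ᶠ x))) ≡⟨ sumL-comm (allFin n) (allFin k) (λ x i → ind (q i ≟ᶠ x)) ⟩
    sumF (λ i → sumF (λ x → ind (q i ≟ᶠ x))) ≡⟨ sumL-cong (allFin k) (λ i → trans
      (sumF-single (λ x → ind (q i ≟ᶠ x)) (q i) (λ x ≢0 → sym (ind-≢0 (q i ≟ᶠ x) ≢0))) (ind-yes (q i ≟ᶠ q i) refl)) ⟩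
    sumF {k} (λ _ → 1) ≡⟨ sumF-1 k ⟩
    k ∎
    where open ≤-Reasoning

  ∣image∣≥ : Injective _≡_ _≡_ q → k ≤ ∣ image ∣
  ∣image∣≥ inj = begin
    k ≡⟨ sumF-1 k ⟨
    sumF {k} (λ _ → 1) ≤⟨ sumL-inject _≟ᶠ_ _ _ q (Unique.allFin⁺ k)
      (λ i _ → ∈-allFin _ , ≤-reflexive (sym (ind-yes (inImage? (q i)) (i , refl)))) (λ _ _ _ _ → inj) ⟩
    sumF (λ x → ind (inImage? x)) ≡⟨ ∣comprehension∣ inImage? ⟨
    ∣ image ∣ ∎
    where open ≤-Reasoning

  -- Puts a short sequence of vertices on a common card, along which a cycle or path can be carried
  -- to the other graph.
  image-extend : ∀ {ℓ} → k ≤ ℓ → ℓ ≤ n → ∃ λ S → (∀ i → q i ∈ S) × ∣ S ∣ ≡ ℓ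
  image-extend {ℓ} k≤ℓ ℓ≤n with between ℓ (⊆⊤ {p = image}) (≤-trans ∣image∣≤ k≤ℓ) (≤-trans ℓ≤n (≤-reflexive (sym (∣⊤∣≡n n))))
  ... | S , image⊆S , _ , size = S , (λ i → image⊆S (∈-image i)) , size

-- Moving towards a vertex set

module _ {n} (G : Graph n) (A : Fin n → Set) (A? : ∀ x → Dec (A x)) (next : Fin n → Fin n) where

  private
    near′? : ∀ k v → Dec (Near (Adj G) A k v)
    near′? = near? (Adj G) A (adj? G) A?

    closer? : ∀ k v → Dec (∃ λ w → Adj G v w × Near (Adj G) A k w)
    closer? k v = any? (λ w → adj? G v w ×-dec near′? k w)

  -- Outside A, towards moves one step along a shortest path to A, of length at most K; inside A it is next.
  towards : ℕ → Fin n → Fin n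
  towards zero v = next v
  towards (suc k) v with near′? k v | closer? k v
  ... | yes _ | _ = towards k v
  ... | no _ | yes (w , _) = w
  ... | no _ | no _ = v

  towards-step : ∀ K {v} → Near (Adj G) A K v → (A v × towards K v ≡ next v) ⊎
    (∃ λ k → k < K × ¬ Near (Adj G) A k v × Adj G v (towards K v) × Near (Adj G) A k (towards K v))
  towards-step zero a = inj₁ (a , refl)
  towards-step (suc k) {v} near with near′? k v | closer? k v
  ... | no ¬near | yes (w , vw , near-w) = inj₂ (k , ≤-refl , ¬near , vw , near-w)
  ... | no ¬near | no ¬closer = case near of λ { (inj₁ n′) → ⊥-elim (¬near n′) ; (inj₂ c) → ⊥-elim (¬closer c) }
  ... | yes near′ | _ with towards-step k near′
  ...   | inj₁ eq = inj₁ eq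
  ...   | inj₂ (j , j<k , rest) = inj₂ (j , m≤n⇒m≤1+n j<k , rest)

  module _ (next-A : ∀ {v} → A v → A (next v)) (K : ℕ) where

    towards-near : ∀ {v} → Near (Adj G) A K v → Near (Adj G) A K (towards K v)
    towards-near {v} near with towards-step K near
    ... | inj₁ (a , eq) = near-mono (Adj G) A {k = K} z≤n (subst A (sym eq) (next-A a))
    ... | inj₂ (k , k<K , _ , _ , near′) = near-mono (Adj G) A (<⇒≤ k<K) near′

    towards-adj : ∀ {v} → (A v → Adj G v (next v)) → Near (Adj G) A K v → Adj G v (towards K v)
    towards-adj {v} next-adj near with towards-step K near
    ... | inj₁ (a , eq) = subst (Adj G v) (sym eq) (next-adj a)
    ... | inj₂ (k , _ , _ , adjacent , _) = adjacent

    -- A step from outside `A` strictly decreases the distance to `A`, so it is never undone by the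
    -- following step; a step within `A` stays in `A` and is governed by `next`.
    towards-≢ : ∀ {v} → (A v → next (next v) ≢ v) → Near (Adj G) A K v → towards K (towards K v) ≢ v
    towards-≢ {v} next-≢ near back with towards-step K near | towards-step K (towards-near near)
    ... | inj₁ (a , eq) | inj₁ (_ , eq′) = next-≢ a (trans (cong next (sym eq)) (trans (sym eq′) back))
    ... | inj₁ (a , eq) | inj₂ (k , _ , ¬near , _) = ¬near (near-mono (Adj G) A {k = k} z≤n (subst A (sym eq) (next-A a)))
    ... | inj₂ (k , _ , ¬near , _) | inj₁ (a , eq) =
      ¬near (near-mono (Adj G) A {k = k} z≤n (subst A (trans (sym eq) back) (next-A a)))
    ... | inj₂ (k , _ , ¬near , _ , near′) | inj₂ (j , _ , ¬near′ , _ , near″) with j ≤? k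
    ...   | yes j≤k = ¬near (near-mono (Adj G) A j≤k (subst (Near (Adj G) A j) back near″))
    ...   | no j≰k = ¬near′ (near-mono (Adj G) A (<⇒≤ (≰⇒> j≰k)) near′)

uniform : ∀ {n} (P : Fin n → ℕ → Set) → (∀ {v j k} → j ≤ k → P v j → P v k) → (∀ v → ∃ (P v)) → ∃ λ K → ∀ v → P v K
uniform {zero} P mono f = 0 , λ ()
uniform {suc n} P mono f with f zero | uniform (P ∘ suc) mono (f ∘ suc)
... | k , p | K , ps = k + K , λ { zero → mono (m≤m+n k K) p ; (suc v) → mono (m≤n+m K k) (ps v) }

walk⇒near : ∀ {n} {G : Graph n} {u v} → Walk G u v → ∃ λ k → Near (Adj G) (_≡ v) k u
walk⇒near here = 0 , refl
walk⇒near (step {v = w} uw p) with walk⇒near p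
... | k , near = suc k , inj₂ (w , uw , near)

-- Every vertex except the root `zero` claims the first edge of a shortest path to the root, which
-- gives n - 1 different edges.
connected⇒edges : ∀ {n} (G : Graph n) → 1 ≤ n → Connected G → n + n ≤ deepPairs G ⊤ 0 + 2
connected⇒edges {n@(suc _)} G _ connected with uniform (λ v k → Near (Adj G) (_≡ zero) k v)
    (near-mono (Adj G) (_≡ zero)) (λ v → walk⇒near (connected v zero))
... | K , near = begin
  n + n ≤⟨ +-mono-≤ n≤ n≤ ⟩
  (others + 1) + (others + 1) ≡⟨ arrange others ⟩
  (others + others) + 2 ≤⟨ +-monoˡ-≤ 2 (orientation (λ v → ¬? (v ≟ᶠ zero)) (deep? G ⊤ 0) p claim (deep-sym G ⊤ 0)
    (λ {v} v≢ → towards-≢ G (_≡ zero) (_≟ᶠ zero) id id K (λ v≡ → ⊥-elim (v≢ v≡)) (near v))) ⟩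
  deepPairs G ⊤ 0 + 2 ∎
  where
  open ≤-Reasoning
  p : Fin n → Fin n
  p = towards G (_≡ zero) (_≟ᶠ zero) id K
  others : ℕ
  others = sumF (λ (v : Fin n) → ind (¬? (v ≟ᶠ zero)))
  claim : ∀ {v} → v ≢ zero → Deep G ⊤ 0 v (p v)
  claim {v} v≢ = ∈⊤ , ∈⊤ , towards-adj G (_≡ zero) (_≟ᶠ zero) id id K (λ v≡ → ⊥-elim (v≢ v≡)) (near v) , _
  arrange : ∀ a → (a + 1) + (a + 1) ≡ (a + a) + 2
  arrange = solve-∀
  n≤ : n ≤ others + 1
  n≤ = begin
    n ≡⟨ sumF-1 n ⟨
    sumF {n} (λ _ → 1) ≤⟨ sumL-mono (allFin n) one ⟩
    sumF (λ (v : Fin n) → ind (¬? (v ≟ᶠ zero)) + ind (v ≟ᶠ zero))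
      ≡⟨ sumL-+ (allFin n) (λ v → ind (¬? (v ≟ᶠ zero))) (λ v → ind (v ≟ᶠ zero)) ⟩
    others + sumF (λ (v : Fin n) → ind (v ≟ᶠ zero))
      ≡⟨ cong (others +_) (sumF-single (λ (v : Fin n) → ind (v ≟ᶠ zero)) zero (λ v ≢0 → ind-≢0 (v ≟ᶠ zero) ≢0)) ⟩
    others + 1 ∎
    where
    one : (v : Fin n) → 1 ≤ ind (¬? (v ≟ᶠ zero)) + ind (v ≟ᶠ zero)
    one zero = ≤-refl
    one (suc v) = ≤-refl

-- Paths and balls in acyclic graphs

module _ {n} (G : Graph n) where

  near-trans : ∀ j {k u v w} → Near (Adj G) (_≡ v) j u → Near (Adj G) (_≡ w) k v → Near (Adj G) (_≡ w) (j + k) u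
  near-trans zero refl near = near
  near-trans (suc j) (inj₁ near) near′ = inj₁ (near-trans j near near′)
  near-trans (suc j) (inj₂ (x , ux , near)) near′ = inj₂ (x , ux , near-trans j near near′)

  near-sym : ∀ k {u v} → Near (Adj G) (_≡ v) k u → Near (Adj G) (_≡ u) k v
  near-sym zero eq = sym eq
  near-sym (suc k) (inj₁ near) = inj₁ (near-sym k near)
  near-sym (suc k) {u} {v} (inj₂ (w , uw , near)) = subst (λ j → Near (Adj G) (_≡ u) j v) (+-comm k 1)
    (near-trans k {1} (near-sym k near) (inj₂ (u , Adj-sym G uw , refl)))

  -- Nonbacktracking walks in a forest are geodesics, by induction on a competing walk. If the
  -- competitor leaves through the same vertex `b`, both are shortened. If it leaves through another
  -- `w`, prepending `w` keeps the walk nonbacktracking and lengthens it, while the competitor from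
  -- `w` is shorter.
  nb-shortest : Acyclic G → ∀ d m {a L} → Nonbacktracking G (a ∷ L) → ∀ k → k ≤ length L →
    Near (Adj G) (_≡ nth d (a ∷ L) k) m a → k ≤ m
  nb-shortest acyclic d zero nb k k≤ eq =
    ≤-reflexive (sym (nth-injective d (acyclic⇒unique acyclic nb) {0} {k} (s≤s z≤n) (s≤s k≤) eq))
  nb-shortest acyclic d (suc m) nb k k≤ (inj₁ near) = m≤n⇒m≤1+n (nb-shortest acyclic d m nb k k≤ near)
  nb-shortest acyclic d (suc m) nb zero k≤ (inj₂ _) = z≤n
  nb-shortest acyclic d (suc m) {a} {b ∷ L} nb (suc k) (s≤s k≤) (inj₂ (w , aw , near)) with w ≟ᶠ b
  ... | yes refl = s≤s (nb-shortest acyclic d m (nb-tail nb) k k≤ near)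
  ... | no w≢b = m≤n⇒m≤1+n (≤-trans (n≤1+n (suc k))
    (nb-shortest acyclic d m (turn (Adj-sym G aw) w≢b nb) (2 + k) (s≤s (s≤s k≤)) near))

  private
    hits : Subset n → List (Fin n) → ℕ
    hits S L = sumL L (λ x → ind (x ∈? S))

  hits-≤ : ∀ d S K L → (∀ k → K ≤ k → k < length L → nth d L k ∉ S) → hits S L ≤ K
  hits-≤ d S K [] missed = z≤n
  hits-≤ d S zero (x ∷ L) missed = subst (_≤ 0) (sym (cong (_+ hits S L) (ind-no (x ∈? S) (missed 0 z≤n (s≤s z≤n)))))
    (hits-≤ d S zero L (λ k _ k< → missed (suc k) z≤n (s≤s k<)))
  hits-≤ d S (suc K) (x ∷ L) missed = +-mono-≤ (ind-≤-1 (x ∈? S)) (hits-≤ d S K L (λ k K≤ k< → missed (suc k) (s≤s K≤) (s≤s k<)))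
    where
    ind-≤-1 : ∀ {P : Set} (d : Dec P) → ind d ≤ 1
    ind-≤-1 d = ind-≤ d (λ _ → ≤-refl)

  hits-≥ : ∀ S T {L} → Unique L → (∀ {x} → x ∈ᴸ L → x ∉ S → x ∈ T) → length L ≤ hits S L + ∣ T ∣
  hits-≥ S T [] rest = z≤n
  hits-≥ S T {x ∷ L} (x∉ ∷ u) rest with x ∈? S
  ... | yes x∈S = s≤s (hits-≥ S T u (rest ∘ there))
  ... | no x∉S = begin
    suc (length L)
      ≤⟨ s≤s (hits-≥ S (T - x) u (λ y∈ y∉S → x∈p∧x≢y⇒x∈p-y (rest (there y∈) y∉S) (λ eq → All.lookup x∉ y∈ (sym eq)))) ⟩
    suc (hits S L + ∣ T - x ∣) ≡⟨ +-suc (hits S L) ∣ T - x ∣ ⟨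
    hits S L + suc (∣ T - x ∣) ≤⟨ +-monoʳ-≤ (hits S L) (x∈p⇒∣p-x∣<∣p∣ (rest (here refl) x∉S)) ⟩
    hits S L + ∣ T ∣ ∎
    where open ≤-Reasoning

  -- Two vertices of `S` are at distance at most 2R, and by `nb-shortest` so are their positions on
  -- the path. After the first hit only 2R further positions can be hits.
  hits-near : Acyclic G → ∀ S R v {L} → (∀ {x} → x ∈ S → Near (Adj G) (_≡ v) R x) → Nonbacktracking G L →
    hits S L ≤ suc (R + R)
  hits-near acyclic S R v {x ∷ L} near nb with x ∈? S
  ... | yes x∈ = s≤s (hits-≤ x S (R + R) L (λ k R+R≤k k< y∈ → <⇒≱ ≤-refl
          (≤-trans (nb-shortest acyclic x (R + R) nb (suc k) k< (near-trans R (near x∈) (near-sym R (near y∈)))) R+R≤k)))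
  hits-near acyclic S R v {x ∷ []} near nb | no _ = z≤n
  hits-near acyclic S R v {x ∷ y ∷ L} near nb | no _ = hits-near acyclic S R v near (nb-tail nb)

  -- At most n - ℓ vertices of the path lie outside `S`, and by `hits-near` at most 2R + 1 lie in
  -- it. Together this gives 2ℓ ≤ n + 2R + 1, one less than the assumed bound allows.
  acyclic-spread : Acyclic G → ∀ {ℓ} R {L} → Nonbacktracking G L → length L ≡ ℓ → R + R + 2 + n ≤ ℓ + ℓ → ℓ ≤ n →
    ∀ S v → ℓ ≤ ∣ S ∣ → ¬ (∀ {x} → x ∈ S → Near (Adj G) (_≡ v) R x)
  acyclic-spread acyclic {ℓ} R {L} nb len big ℓ≤n S v size near = <-irrefl refl (begin-strict
    ℓ + ℓ ≡⟨ cong (_+ ℓ) len ⟨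
    length L + ℓ ≤⟨ +-monoˡ-≤ ℓ (hits-≥ S (∁ S) (acyclic⇒unique acyclic nb) (λ _ → x∉p⇒x∈∁p)) ⟩
    hits S L + ∣ ∁ S ∣ + ℓ
      ≤⟨ +-monoˡ-≤ ℓ (+-mono-≤ (hits-near acyclic S R v near nb) (≤-trans (≤-reflexive (∣∁p∣≡n∸∣p∣ S)) (∸-monoʳ-≤ n size))) ⟩
    suc (R + R) + (n ∸ ℓ) + ℓ ≡⟨ trans (+-assoc (suc (R + R)) (n ∸ ℓ) ℓ) (cong (suc (R + R) +_) (m∸n+n≡m ℓ≤n)) ⟩
    suc (R + R) + n <⟨ ≤-reflexive (arrange (R + R) n) ⟩
    R + R + 2 + n ≤⟨ big ⟩
    ℓ + ℓ ∎)
    where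
    open ≤-Reasoning
    arrange : ∀ a n → suc (suc a + n) ≡ a + 2 + n
    arrange = solve-∀

-- Stars and small balls

Inside : ∀ {n} → Graph n → Subset n → Fin n → Fin n → Set
Inside G S u w = Adj G u w × u ∈ S × w ∈ S

-- Distances are measured inside `S`, so that an embedding of `S` cannot increase them.
Star : ∀ {n} → Graph n → ℕ → Subset n → Fin n → Set
Star G R S v = v ∈ S × ∀ {x} → x ∈ S → Near (Inside G S) (_≡ v) R x

module _ {n} (G : Graph n) where

  -- After its first vertex, a walk of at most i + 1 steps to `v` stays in the ball of radius i,
  -- hence in `S`.
  near-inside : ∀ {S} i v → ball G i v ⊆ S → ∀ j {x} → j ≤ i → x ∈ S → Near (Adj G) (_≡ v) (suc j) x →
    Near (Inside G S) (_≡ v) (suc j) x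
  near-inside i v ball⊆S zero j≤ x∈ (inj₁ eq) = inj₁ eq
  near-inside i v ball⊆S (suc j) j≤ x∈ (inj₁ near) = inj₁ (near-inside i v ball⊆S j (<⇒≤ j≤) x∈ near)
  near-inside {S} i v ball⊆S j {x} j≤ x∈ (inj₂ (w , xw , near)) = inj₂ (w , (xw , x∈ , w∈) , rest j j≤ near)
    where
    w∈ : w ∈ S
    w∈ = ball⊆S (∈-comprehension⁺ (nearVertex? G i v) (near-mono (Adj G) (_≡ v) j≤ near))
    rest : ∀ j → j ≤ i → Near (Adj G) (_≡ v) j w → Near (Inside G S) (_≡ v) j w
    rest zero _ eq = eq
    rest (suc j) j≤ near = near-inside i v ball⊆S j (<⇒≤ j≤) w∈ near

  -- A ball with at least ℓ vertices contains an ℓ-set between two consecutive balls, which is a star.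
  starFree⇒smallBalls : ∀ {ℓ} R → 1 < ℓ → (∀ S v → ∣ S ∣ ≡ ℓ → ¬ Star G R S v) → ∀ v → ∣ ball G R v ∣ < ℓ
  starFree⇒smallBalls {ℓ} R 1<ℓ starFree v = go R ≤-refl
    where
    go : ∀ i → i ≤ R → ∣ ball G i v ∣ < ℓ
    go zero _ = ≤-<-trans (≤-trans (p⊆q⇒∣p∣≤∣q∣ (λ {x} x∈ →
         subst (_∈ ⁅ v ⁆) (sym (∈-comprehension⁻ (nearVertex? G 0 v) x∈)) (x∈⁅x⁆ v)))
      (≤-reflexive (∣⁅x⁆∣≡1 v))) 1<ℓ
    go (suc i) i<R with ℓ ≤? ∣ ball G (suc i) v ∣
    ... | no ℓ≰ = ≰⇒> ℓ≰
    ... | yes ℓ≤ with between ℓ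
                       (λ {x} x∈ → ∈-comprehension⁺ (nearVertex? G (suc i) v) {x} (inj₁ (∈-comprehension⁻ (nearVertex? G i v) x∈)))
                       (<⇒≤ (go i (<⇒≤ i<R))) ℓ≤
    ...   | S , ball⊆S , S⊆ball , size = ⊥-elim (starFree S v size
            ( ball⊆S (∈-comprehension⁺ (nearVertex? G i v) (near-mono (Adj G) (_≡ v) {k = i} z≤n refl))
            , λ {x} x∈ → near-mono (Inside G S) (_≡ v) i<R
                (near-inside i v ball⊆S i ≤-refl x∈ (∈-comprehension⁻ (nearVertex? G (suc i) v) (S⊆ball x∈)))))

module _ {n} {G G′ : Graph n} {S S′ : Subset n} (e : Embedding G S G′ S′) where
  open Embedding e

  private
    image? : ∀ y → Dec (∃ λ x → x ∈ S × to x ≡ y)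
    image? y = any? (λ x → x ∈? S ×-dec to x ≟ᶠ y)

  star-embed : ∀ {R v} → Star G R S v →
    ∃ λ T → ∣ S ∣ ≤ ∣ T ∣ × (∀ {y} → y ∈ T → Near (Adj G′) (_≡ to v) R y)
  star-embed {R} {v} (v∈ , near) = comprehension image? , size , near′
    where
    size : ∣ S ∣ ≤ ∣ comprehension image? ∣
    size = ≤-trans (≤-reflexive (∣∣-sum S)) (≤-trans
      (sumL-inject _≟ᶠ_ (λ v → ind (v ∈? S)) (λ y → ind (image? y)) to (Unique.allFin⁺ n)
        (λ x _ → ∈-allFin _ , ind-mono (x ∈? S) (image? (to x)) (λ x∈ → x , x∈ , refl))
        (λ x y p q → to-inj (ind-≢0 (x ∈? S) p) (ind-≢0 (y ∈? S) q)))
      (≤-reflexive (sym (∣comprehension∣ image?))))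
    near′ : ∀ {y} → y ∈ comprehension image? → Near (Adj G′) (_≡ to v) R y
    near′ y∈ with ∈-comprehension⁻ image? y∈
    ... | x , x∈ , refl = near-map to (λ (xy , x∈ , y∈) → to-Adj e x∈ y∈ xy) (cong to) R (near x∈)

  cycle-embed : (C : Cycle G) → (∀ i → Cycle.c C i ∈ S) → Cycle G′
  cycle-embed C c∈ = record
    { m = m
    ; c = to ∘ c
    ; inj = λ eq → inj (to-inj (c∈ _) (c∈ _) eq)
    ; edges = λ i → to-Adj e (c∈ _) (c∈ _) (edges i)
    ; close = to-Adj e (c∈ _) (c∈ _) close
    }
    where open Cycle C

-- Paths from sequences and the cyclic successor

nb-tabulate : ∀ {n} {G : Graph n} k (q : Fin (suc k) → Fin n) → Injective _≡_ _≡_ q →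
  (∀ i → Adj G (q (inject₁ i)) (q (suc i))) → Nonbacktracking G (tabulate q)
nb-tabulate zero q inj consecutive = single
nb-tabulate (suc zero) q inj consecutive = edge (consecutive zero)
nb-tabulate (suc (suc k)) q inj consecutive = turn (consecutive zero) (λ eq → case inj eq of λ ())
  (nb-tabulate (suc k) (q ∘ suc) (λ eq → case inj eq of λ { refl → refl }) (consecutive ∘ suc))

cyclicSuc : ∀ {k} → Fin (suc k) → Fin (suc k)
cyclicSuc i with view i
... | ‵fromℕ = zero
... | ‵inject₁ j = suc j

cyclicSuc-cases : ∀ {k} (i : Fin (suc k)) → (cyclicSuc i ≡ zero × toℕ i ≡ k) ⊎ toℕ (cyclicSuc i) ≡ suc (toℕ i)
cyclicSuc-cases {k} i with view i
... | ‵fromℕ = inj₁ (refl , toℕ-fromℕ k)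
... | ‵inject₁ j = inj₂ (cong suc (sym (toℕ-inject₁ j)))

cyclicSuc²-≢ : ∀ {k} (i : Fin (3 + k)) → cyclicSuc (cyclicSuc i) ≢ i
cyclicSuc²-≢ i eq with cyclicSuc-cases i | cyclicSuc-cases (cyclicSuc i)
... | inj₁ (z , _) | inj₁ (_ , last) = case trans (sym (cong toℕ z)) last of λ ()
... | inj₁ (z , last) | inj₂ s = case trans (sym last) (trans (sym (cong toℕ eq)) (trans s (cong (suc ∘ toℕ) z))) of λ ()
... | inj₂ s | inj₁ (z , last) = case trans (sym last) (trans s (cong (suc ∘ toℕ) (trans (sym eq) z))) of λ ()
... | inj₂ s | inj₂ s′ = 1+n≢n {toℕ i} (≤-antisym (≤-trans (n≤1+n _) (≤-reflexive two)) (n≤1+n _))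
  where
  two : suc (suc (toℕ i)) ≡ toℕ i
  two = trans (sym (trans s′ (cong suc s))) (cong toℕ eq)

-- The cyclic case and the theorem

module _ {n} (G : Graph n) (C : Cycle G) where
  open Cycle C

  OnCycle : Fin n → Set
  OnCycle x = ∃ λ i → c i ≡ x

  onCycle? : ∀ x → Dec (OnCycle x)
  onCycle? = inImage? c

  nextOnCycle : Fin n → Fin n
  nextOnCycle x with onCycle? x
  ... | yes (i , _) = c (cyclicSuc i)
  ... | no _ = x

  nextOnCycle-≡ : ∀ {x} → OnCycle x → ∃ λ i → c i ≡ x × nextOnCycle x ≡ c (cyclicSuc i)
  nextOnCycle-≡ {x} on with onCycle? x
  ... | yes (i , eq) = i , eq , refl
  ... | no off = ⊥-elim (off on)

  nextOnCycle-on : ∀ {x} → OnCycle x → OnCycle (nextOnCycle x)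
  nextOnCycle-on on with nextOnCycle-≡ on
  ... | i , _ , eq = cyclicSuc i , sym eq

  adj-cyclicSuc : ∀ i → Adj G (c i) (c (cyclicSuc i))
  adj-cyclicSuc i with view i
  ... | ‵fromℕ = close
  ... | ‵inject₁ j = edges j

  nextOnCycle-adj : ∀ {x} → OnCycle x → Adj G x (nextOnCycle x)
  nextOnCycle-adj on with nextOnCycle-≡ on
  ... | i , refl , eq = subst (Adj G (c i)) (sym eq) (adj-cyclicSuc i)

  nextOnCycle-≢ : ∀ {x} → OnCycle x → nextOnCycle (nextOnCycle x) ≢ x
  nextOnCycle-≢ on back with nextOnCycle-≡ on | nextOnCycle-≡ (nextOnCycle-on on)
  ... | i , refl , eq | j , eq′ , eq″ = cyclicSuc²-≢ i (trans (cong cyclicSuc (sym j≡)) (inj (trans (sym eq″) back)))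
    where
    j≡ : j ≡ cyclicSuc i
    j≡ = inj (trans eq′ eq)

  module _ (r : ℕ) where
    private
      K : ℕ
      K = suc r

      NearCycle : ℕ → Fin n → Set
      NearCycle = Near (Adj G) OnCycle

      p : Fin n → Fin n
      p = towards G OnCycle onCycle? nextOnCycle K

      p-near : ∀ {v} → NearCycle K v → NearCycle K (p v)
      p-near = towards-near G OnCycle onCycle? nextOnCycle nextOnCycle-on K

      p-adj : ∀ {v} → NearCycle K v → Adj G v (p v)
      p-adj = towards-adj G OnCycle onCycle? nextOnCycle nextOnCycle-on K nextOnCycle-adj

      p-≢ : ∀ {v} → NearCycle K v → p (p v) ≢ v
      p-≢ = towards-≢ G OnCycle onCycle? nextOnCycle nextOnCycle-on K nextOnCycle-≢

      -- Iterating `p` never backtracks and never leaves the neighbourhood of the cycle, so it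
      -- supplies rays of every length.
      rayForth : ∀ s {v} → NearCycle K v → Ray G ⊤ s (p v) v
      rayForth zero near = _
      rayForth (suc s) near = _ , ∈⊤ , p-adj (p-near near) , p-≢ near , rayForth s (p-near near)

      -- Beyond `p v` the ray comes from `rayForth`. Behind `v`, either `u` is `p v` and the given
      -- ray from `v` serves, or the ray steps to `u` and follows the given ray from `u`, truncated
      -- by one step.
      claim : ∀ {v} → NearCycle K v → ∃ (Deep G ⊤ r v) → Deep G ⊤ r v (p v)
      claim {v} near (u , _ , _ , vu , ray , ray′) = ∈⊤ , ∈⊤ , p-adj near , rayBack r ray ray′ , rayForth r near
        where
        rayBack : ∀ r → Ray G ⊤ r v u → Ray G ⊤ r u v → Ray G ⊤ r v (p v)
        rayBack zero _ _ = _
        rayBack (suc r) ray ray′ with u ≟ᶠ p v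
        ... | yes refl = ray
        ... | no u≢ = u , ∈⊤ , vu , u≢ , ray-pred G ⊤ r ray′

    deepVertices-≥ : (∀ {v} → ∃ (Deep G ⊤ r v) → NearCycle K v) →
      deepVertices G ⊤ r + deepVertices G ⊤ r ≤ deepPairs G ⊤ r
    deepVertices-≥ near = orientation (deepVertex? G ⊤ r) (deep? G ⊤ r) p (λ d → claim (near d) d) (deep-sym G ⊤ r) (p-≢ ∘ near)

    -- The iterates of `p` from a cycle vertex form a nonbacktracking walk. Its edge from `x r` to
    -- `x (suc r)` has r edges behind it and can be continued by r edges.
    deepVertices->0 : 1 ≤ deepVertices G ⊤ r
    deepVertices->0 = ≤-trans (≤-reflexive (sym (ind-yes (deepVertex? G ⊤ r (x r)) (x (suc r) , deep))))
      (sumF-∈ (λ v → ind (deepVertex? G ⊤ r v)) (x r))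
      where
      x : ℕ → Fin n
      x zero = c zero
      x (suc i) = p (x i)
      x-near : ∀ i → NearCycle K (x i)
      x-near zero = near-mono (Adj G) OnCycle {k = K} z≤n (zero , refl)
      x-near (suc i) = p-near (x-near i)
      rayBack : ∀ i → Ray G ⊤ i (x i) (x (suc i))
      rayBack zero = _
      rayBack (suc i) = x i , ∈⊤ , Adj-sym G (p-adj (x-near i)) , (λ eq → p-≢ (x-near i) (sym eq)) , rayBack i
      deep : Deep G ⊤ r (x r) (x (suc r))
      deep = ∈⊤ , ∈⊤ , p-adj (x-near r) , rayBack r , rayForth r (x-near r)

    private
      Off : Fin n → Set
      Off x = ¬ OnCycle x

      off : ∀ s {x} → ¬ NearCycle s x → Off x
      off s far on = far (near-mono (Adj G) OnCycle {k = s} z≤n on)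

      step-far : ∀ s {u w} → ¬ NearCycle (suc s) u → Adj G u w → ¬ NearCycle s w
      step-far s far uw near = far (inj₂ (_ , uw , near))

      -- A vertex at distance more than s from the cycle can be left by s steps without meeting the
      -- cycle; the margin drops by one per step.
      rayList : ∀ s {u v} → Ray G ⊤ s u v → Adj G v u → ¬ NearCycle s u → Off v →
        ∃ λ ws → Nonbacktracking G (v ∷ u ∷ ws) × length ws ≡ s × All Off (v ∷ u ∷ ws)
      rayList zero _ vu far off-v = [] , edge vu , refl , off-v ∷ off 0 far ∷ []
      rayList (suc s) {u} {v} (w , _ , uw , w≢v , ray) vu far off-v
        with rayList s ray uw (step-far s far uw) (off (suc s) far)
      ... | ws , nb , len , offs = w ∷ ws , turn vu (λ eq → w≢v (sym eq)) nb , cong suc len , off-v ∷ offs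

      -- Prepends the ray from `v` in reverse, so that the list becomes a single walk through the
      -- deep edge.
      extendList : ∀ s {v u ws} → Ray G ⊤ s v u → ¬ NearCycle s v → Nonbacktracking G (v ∷ u ∷ ws) → All Off (v ∷ u ∷ ws) →
        ∃ λ L → Nonbacktracking G L × length L ≡ s + (2 + length ws) × All Off L
      extendList zero {v} {u} {ws} _ _ nb offs = v ∷ u ∷ ws , nb , refl , offs
      extendList (suc s) {v} {u} {ws} (w , _ , vw , w≢u , ray) far nb offs
        with extendList s ray (step-far s far vw) (turn (Adj-sym G vw) w≢u nb) (off s (step-far s far vw) ∷ offs)
      ... | L , nb′ , len , offs′ = L , nb′ , trans len (+-suc s (2 + length ws)) , offs′

    -- Otherwise a nonbacktracking walk on 2r + 2 vertices misses the cycle; it is a path because it is too short to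
    -- contain a cycle, so there are too few vertices for it.
    deep-near : ∀ {ℓ} → (∀ (C : Cycle G) → ℓ < cycleLength C) → r + r + 2 ≤ ℓ → n ≤ ℓ + suc (r + r) →
      ∀ {v} → ∃ (Deep G ⊤ r v) → NearCycle K v
    deep-near {ℓ} long short few {v} (u , _ , _ , vu , ray , ray′) =
      decidable-stable (near? (Adj G) OnCycle (adj? G) onCycle? K v) λ far →
        case rayList r ray′ vu (step-far r far vu) (off K far) of λ
          { (ws , nb , len , offs) → case extendList r ray (λ near → far (inj₁ near)) nb offs of λ
            { (L , nb′ , len′ , offs′) → contradict L nb′ (trans len′ (cong (λ k → r + (2 + k)) len)) offs′ } }
      where
      contradict : ∀ L → Nonbacktracking G L → length L ≡ r + (2 + r) → All Off L → ⊥
      contradict L nb len offs with nb-unique⊎cycle nb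
      ... | inj₂ (C′ , lt) = <-irrefl refl (<-trans (long C′) (<-≤-trans lt
              (≤-trans (≤-reflexive (trans len (arrange r))) short)))
        where
        arrange : ∀ r → r + (2 + r) ≡ r + r + 2
        arrange = solve-∀
      ... | inj₁ unique = <-irrefl refl (begin-strict
        n ≤⟨ few ⟩
        ℓ + suc (r + r) <⟨ ≤-reflexive (arrange ℓ r) ⟩
        ℓ + (r + (2 + r)) ≡⟨ cong (ℓ +_) len ⟨
        ℓ + length L ≤⟨ +-mono-≤ (<⇒≤ (long C)) (unique-length (∁ (image c)) unique
          (λ x∈ → x∉p⇒x∈∁p (λ on → All.lookup offs x∈ (∈-comprehension⁻ (inImage? c) on)))) ⟩
        cycleLength C + ∣ ∁ (image c) ∣ ≡⟨ cong (cycleLength C +_) (∣∁p∣≡n∸∣p∣ (image c)) ⟩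
        cycleLength C + (n ∸ ∣ image c ∣) ≤⟨ +-monoʳ-≤ (cycleLength C) (∸-monoʳ-≤ n (∣image∣≥ c inj)) ⟩
        cycleLength C + (n ∸ cycleLength C) ≡⟨ m+[n∸m]≡n (≤-trans (∣image∣≥ c inj) (∣p∣≤n (image c))) ⟩
        n ∎)
        where
        open ≤-Reasoning
        arrange : ∀ ℓ r → suc (ℓ + suc (r + r)) ≡ ℓ + (r + (2 + r))
        arrange = solve-∀

-- The forest of deep edges

module _ {n} (G : Graph n) (r : ℕ) where

  deepGraph : Graph n
  deepGraph = record
    { adj = λ u v → does (deep? G ⊤ r u v)
    ; sym = λ u v → does-⇔ (mk⇔ (deep-sym G ⊤ r) (deep-sym G ⊤ r)) (deep? G ⊤ r u v) (deep? G ⊤ r v u)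
    ; irrefl = λ v → dec-false (deep? G ⊤ r v v) (λ (_ , _ , vv , _) → adj-≢ G vv refl)
    }

  deepGraph-adj : ∀ {u v} → Adj deepGraph u v → Adj G u v
  deepGraph-adj {u} {v} uv = proj₁ (proj₂ (proj₂ (does-true (deep? G ⊤ r u v) uv)))

  deepGraph-acyclic : Acyclic G → Acyclic deepGraph
  deepGraph-acyclic acyclic C = acyclic record
    { m = m ; c = c ; inj = inj ; edges = λ i → deepGraph-adj (edges i) ; close = deepGraph-adj close }
    where open Cycle C

  -- Deep pairs of `G` are ordinary edges of `deepGraph` between deep vertices, so `forest` applies
  -- to the nonempty set `S` of deep vertices.
  deepPairs-≤ : Acyclic G → 1 ≤ deepVertices G ⊤ r → deepPairs G ⊤ r + 2 ≤ deepVertices G ⊤ r + deepVertices G ⊤ r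
  deepPairs-≤ acyclic nonempty = begin
    deepPairs G ⊤ r + 2 ≤⟨ +-monoˡ-≤ 2 (sumF₂-mono λ u v → ind-mono (deep? G ⊤ r u v) (deep? deepGraph S 0 u v)
      λ d → inS (v , d) , inS (u , deep-sym G ⊤ r d) , dec-true (deep? G ⊤ r u v) d , _) ⟩
    deepPairs deepGraph S 0 + 2 ≤⟨ proj₁ (forest deepGraph (deepGraph-acyclic acyclic) ∣ S ∣ S ≤-refl (inS (proj₂ deepVertex))) ⟩
    ∣ S ∣ + ∣ S ∣ ≡⟨ cong₂ _+_ (∣comprehension∣ (deepVertex? G ⊤ r)) (∣comprehension∣ (deepVertex? G ⊤ r)) ⟩
    deepVertices G ⊤ r + deepVertices G ⊤ r ∎
    where
    open ≤-Reasoning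
    S : Subset n
    S = comprehension (deepVertex? G ⊤ r)
    inS : ∀ {v} → ∃ (Deep G ⊤ r v) → v ∈ S
    inS = ∈-comprehension⁺ (deepVertex? G ⊤ r)
    deepVertex : ∃ λ v → ∃ (Deep G ⊤ r v)
    deepVertex with sumL-≢0 (allFin n) (λ v → ind (deepVertex? G ⊤ r v)) (λ eq → case subst (1 ≤_) eq nonempty of λ ())
    ... | v , ≢0 = v , ind-≢0 (deepVertex? G ⊤ r v) ≢0

half : ∀ t → ∃ λ r → r + r ≤ t × t ≤ suc (r + r)
half zero = 0 , z≤n , z≤n
half (suc zero) = 0 , z≤n , s≤s z≤n
half (suc (suc t)) with half t
... | r , lo , hi = suc r , s≤s (subst (_≤ suc t) (sym (+-suc r r)) (s≤s lo)) ,
  s≤s (s≤s (subst (t ≤_) (sym (+-suc r r)) hi))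

∣pair∣≤2 : ∀ {n} (u v : Fin n) → ∣ ⁅ u ⁆ ∪ ⁅ v ⁆ ∣ ≤ 2
∣pair∣≤2 {n} u v = ≤-trans (p⊆q⇒∣p∣≤∣q∣ pair⊆) (∣image∣≤ q)
  where
  q : Fin 2 → Fin n
  q zero = u
  q (suc zero) = v
  pair⊆ : ⁅ u ⁆ ∪ ⁅ v ⁆ ⊆ image q
  pair⊆ {x} x∈ with x∈p∪q⁻ ⁅ u ⁆ ⁅ v ⁆ x∈
  ... | inj₁ x∈u = subst (_∈ image q) (sym (x∈⁅y⁆⇒x≡y u x∈u)) (∈-image q zero)
  ... | inj₂ x∈v = subst (_∈ image q) (sym (x∈⁅y⁆⇒x≡y v x∈v)) (∈-image q (suc zero))

-- Transferring the tree property along the deck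

module _ {n ℓ} (2n+4≤3ℓ : 2 * n + 4 ≤ 3 * ℓ) (ℓ≤n : ℓ ≤ n) {G G′ : Graph n}
  (d : DeckEmbedding ℓ G G′) (d′ : DeckEmbedding ℓ G′ G) where
  open DeckEmbedding

  private
    1<ℓ : 1 < ℓ
    1<ℓ = ≰⇒> λ ℓ≤1 → <⇒≱ (≤-trans (m≤n+m 4 (2 * n)) 2n+4≤3ℓ) (*-monoʳ-≤ 3 ℓ≤1)

    t : ℕ
    t = n ∸ ℓ

    t+ℓ≡n : t + ℓ ≡ n
    t+ℓ≡n = m∸n+n≡m ℓ≤n

    small : ∀ {k} → k ≤ ℓ → k + t ≤ n
    small k≤ℓ = ≤-trans (+-monoˡ-≤ t k≤ℓ) (≤-reflexive (trans (+-comm ℓ t) t+ℓ≡n))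

    -- Adding ℓ to both sides and using t + ℓ = n turns this into the hypothesis 2n + 4 ≤ 3ℓ.
    t+4+n≤2ℓ : t + 4 + n ≤ ℓ + ℓ
    t+4+n≤2ℓ = +-cancelʳ-≤ ℓ _ _ (begin
      t + 4 + n + ℓ ≡⟨ arrange t n ℓ ⟩
      (t + ℓ) + n + 4 ≡⟨ cong (λ k → k + n + 4) t+ℓ≡n ⟩
      n + n + 4 ≡⟨ cong (_+ 4) (arrange′ n) ⟩
      2 * n + 4 ≤⟨ 2n+4≤3ℓ ⟩
      3 * ℓ ≡⟨ arrange″ ℓ ⟩
      ℓ + ℓ + ℓ ∎)
      where
      open ≤-Reasoning
      arrange : ∀ t n ℓ → t + 4 + n + ℓ ≡ (t + ℓ) + n + 4
      arrange = solve-∀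
      arrange′ : ∀ n → n + n ≡ 2 * n
      arrange′ = solve-∀
      arrange″ : ∀ ℓ → 3 * ℓ ≡ ℓ + ℓ + ℓ
      arrange″ = solve-∀

    r : ℕ
    r = proj₁ (half t)

    t+4≤ℓ : t + 4 ≤ ℓ
    t+4≤ℓ = +-cancelʳ-≤ n _ _ (≤-trans t+4+n≤2ℓ (+-monoʳ-≤ ℓ ℓ≤n))

    2r+2≤ℓ : r + r + 2 ≤ ℓ
    2r+2≤ℓ = ≤-trans (+-mono-≤ (proj₁ (proj₂ (half t))) (s≤s (s≤s (z≤n {2})))) t+4≤ℓ

    n≤ℓ+2r+1 : n ≤ ℓ + suc (r + r)
    n≤ℓ+2r+1 = ≤-trans (≤-reflexive (trans (sym t+ℓ≡n) (+-comm t ℓ))) (+-monoʳ-≤ ℓ (proj₂ (proj₂ (half t))))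

    -- The condition of `acyclic-spread` for balls of radius R = r + 1: here 2R + 2 = 2r + 4 ≤ t +
    -- 4.
    2R+2+n≤2ℓ : suc r + suc r + 2 + n ≤ ℓ + ℓ
    2R+2+n≤2ℓ = ≤-trans (≤-trans (≤-reflexive (arrange r n)) (+-monoˡ-≤ n (+-monoˡ-≤ 4 (proj₁ (proj₂ (half t)))))) t+4+n≤2ℓ
      where
      arrange : ∀ r n → suc r + suc r + 2 + n ≡ r + r + 4 + n
      arrange = solve-∀

  sameEdges : deepPairs G ⊤ 0 ≡ deepPairs G′ ⊤ 0
  sameEdges = deckDetermined ℓ≤n d d′ (λ G S → deepPairs G S 0) (deepPairs-monotone 0) (divisible G) (divisible G′)
    where
    divisible : ∀ G → Divisible t (λ S → deepPairs G S 0)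
    divisible G = edges-divisible G (λ u v → small (≤-trans (∣pair∣≤2 u v) 1<ℓ))

  -- A cycle on at most ℓ vertices would fit on a card of `G′` and reappear in `G`.
  cycles-long : Acyclic G → (C : Cycle G′) → ℓ < cycleLength C
  cycles-long acyclic C = ≰⇒> λ short → case image-extend (Cycle.c C) short ℓ≤n of λ
    { (S , c∈ , size) → acyclic (cycle-embed (card-emb d′ S size) C c∈) }

  longPath : Cycle G′ → Acyclic G → ∃ λ L → Nonbacktracking G L × length L ≡ ℓ
  longPath C acyclic = path ℓ refl
    where
    open Cycle C
    -- ℓ is replaced by a variable `k` so that it can be matched as a successor.
    path : ∀ k → k ≡ ℓ → ∃ λ L → Nonbacktracking G L × length L ≡ ℓ
    path zero refl = case 1<ℓ of λ ()
    path (suc k) refl = case image-extend q ≤-refl ℓ≤n of λ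
      { (S , q∈ , size) → let open Embedding (card-emb d′ S size) in
        tabulate (to ∘ q) ,
        nb-tabulate k (to ∘ q) (λ {i} {j} eq → inject≤-injective _ _ i j (inj (to-inj (q∈ i) (q∈ j) eq)))
          (λ i → to-Adj (card-emb d′ S size) (q∈ _) (q∈ _) (consecutive i)) ,
        length-tabulate (to ∘ q) }
      where
      fits : suc k ≤ cycleLength C
      fits = <⇒≤ (cycles-long acyclic C)
      q : Fin (suc k) → Fin n
      q i = c (inject≤ i fits)
      consecutive : ∀ i → Adj G′ (q (inject₁ i)) (q (suc i))
      consecutive i = subst (λ j → Adj G′ (c j) (q (suc i)))
        (toℕ-injective (trans (toℕ-inject₁ _) (trans (toℕ-inject≤ i (≤-pred fits))
          (sym (trans (toℕ-inject≤ (inject₁ i) fits) (toℕ-inject₁ i))))))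
        (edges (inject≤ i (≤-pred fits)))

  acyclic-transfer : Acyclic G → Acyclic G′
  acyclic-transfer acyclic C with longPath C acyclic
  -- With P deep pairs and V deep vertices, the contradiction is P + 2 ≤ 2V = 2V′ ≤ P′ = P.
  ... | L , nb , len = <⇒≱ (m<m+n (deepPairs G ⊤ r) (s≤s z≤n))
    (≤-trans upper (≤-trans (≤-reflexive (cong₂ _+_ sameVertices sameVertices)) (≤-trans lower (≤-reflexive (sym samePairs)))))
    where
    starFree : ∀ S v → ∣ S ∣ ≡ ℓ → ¬ Star G (suc r) S v
    starFree S v size (_ , near) = acyclic-spread G acyclic (suc r) nb len 2R+2+n≤2ℓ ℓ≤n S v (≤-reflexive (sym size))
      (λ x∈ → near-map id proj₁ id (suc r) (near x∈))
    -- A star of `G′` is carried by its card to a set of at least ℓ vertices within distance r + 1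
    -- of one vertex of `G`.
    starFree′ : ∀ S v → ∣ S ∣ ≡ ℓ → ¬ Star G′ (suc r) S v
    starFree′ S v size star with star-embed (card-emb d′ S size) {suc r} star
    ... | T , S≤T , near = acyclic-spread G acyclic (suc r) nb len 2R+2+n≤2ℓ ℓ≤n T _ (subst (_≤ ∣ T ∣) size S≤T) near
    small-G : ∀ v → ∣ ball G (suc r) v ∣ + t ≤ n
    small-G v = small (<⇒≤ (starFree⇒smallBalls G (suc r) 1<ℓ starFree v))
    small-G′ : ∀ v → ∣ ball G′ (suc r) v ∣ + t ≤ n
    small-G′ v = small (<⇒≤ (starFree⇒smallBalls G′ (suc r) 1<ℓ starFree′ v))
    sameVertices : deepVertices G ⊤ r ≡ deepVertices G′ ⊤ r
    sameVertices = deckDetermined ℓ≤n d d′ (λ G S → deepVertices G S r) (deepVertices-monotone r)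
      (deepVertices-divisible G r small-G) (deepVertices-divisible G′ r small-G′)
    samePairs : deepPairs G ⊤ r ≡ deepPairs G′ ⊤ r
    samePairs = deckDetermined ℓ≤n d d′ (λ G S → deepPairs G S r) (deepPairs-monotone r)
      (deepPairs-divisible G r small-G) (deepPairs-divisible G′ r small-G′)

    upper : deepPairs G ⊤ r + 2 ≤ deepVertices G ⊤ r + deepVertices G ⊤ r
    upper = deepPairs-≤ G r acyclic (subst (1 ≤_) (sym sameVertices) (deepVertices->0 G′ C r))
    lower : deepVertices G′ ⊤ r + deepVertices G′ ⊤ r ≤ deepPairs G′ ⊤ r
    lower = deepVertices-≥ G′ C r (deep-near G′ C r (cycles-long acyclic) 2r+2≤ℓ n≤ℓ+2r+1)

  connected-transfer : 1 ≤ n → Connected G → Acyclic G′ → Connected G′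
  connected-transfer 1≤n connected acyclic u v with forest G′ acyclic n ⊤ (≤-reflexive (∣⊤∣≡n n)) (∈⊤ {x = u})
  ... | _ , inj₂ walks = walks ∈⊤ ∈⊤
  -- Here P′ + 4 ≤ 2n for the number P′ of ordered adjacent pairs of `G′`, whereas connectedness of
  -- `G` and `sameEdges` give 2n ≤ P′ + 2.
  ... | _ , inj₁ few = ⊥-elim (<⇒≱ (+-monoʳ-< (deepPairs G′ ⊤ 0) {2} {4} (s≤s (s≤s (s≤s z≤n)))) (≤-trans few (≤-trans
    (≤-reflexive (cong₂ _+_ (∣⊤∣≡n n) (∣⊤∣≡n n))) (≤-trans (connected⇒edges G 1≤n connected) (≤-reflexive (cong (_+ 2) sameEdges))))))

  tree-transfer : 1 ≤ n → IsTree G → IsTree G′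
  tree-transfer 1≤n (connected , acyclic) = connected-transfer 1≤n connected acyclic′ , acyclic′
    where
    acyclic′ : Acyclic G′
    acyclic′ = acyclic-transfer acyclic

theorem1p6 : (n ℓ : ℕ) → 1 ≤ n → 2 * n + 4 ≤ 3 * ℓ → ℓ ≤ n →
    (G G' : Graph n) → SameDeck ℓ G G' → (IsTree G ⇔ IsTree G')
theorem1p6 n ℓ 1≤n 2n+4≤3ℓ ℓ≤n G G' same = mk⇔ (tree-transfer 2n+4≤3ℓ ℓ≤n d d′ 1≤n) (tree-transfer 2n+4≤3ℓ ℓ≤n d′ d 1≤n)
  where
  d : DeckEmbedding ℓ G G'
  d = sameDeck⇒deckEmbedding same
  d′ : DeckEmbedding ℓ G' G
  d′ = sameDeck⇒deckEmbeddingʳ same
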